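{- Let $G=(V,E)$ be a connected, $d$-regular graph on $n$ vertices, let $A$ be its adjacency matrix and $D = d\cdot I_n$ the diagonal matrix of vertex degrees, and let $1 = \lambda_1 \geq |\lambda_2| \geq \dots \geq |\lambda_n| \geq 0$ be the eigenvalues of the symmetric matrix $AD^{ -1}$, ordered by absolute value. Let $1 \leq \ell \leq n-1$. Then there exists a probability measure $\mu_0$ on $V$ supported on at most $\ell$ vertices such that the sequence of measures defined by $\mu_{k+1} = AD^{ -1}\mu_k$ satisfies, for all integers $k \geq 0$, $$\sum_{v\in V}\left|\mu_k(v) - \frac{1}{n}\right|^2 \leq \lambda_{\ell+1}^{2k}.$$
   Context: Probability measures on $V=\{v_1,\dots,v_n\}$ are identified with vectors in $\mathbb{R}^n_{\geq 0}$ whose entries sum to $1$; the support of a measure is the set of vertices with nonzero mass. $AD^{ -1}=\frac1d A$ acts on such vectors by matrix multiplication (this is one step of the simple random walk). -}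

module Defs where

open import Algebra.Bundles using (CommutativeRing; Semiring)
import Algebra.Definitions.RawSemiring as RawSemiringDefs
open import Algebra.Core using (Op₁)
open import Data.Bool.Base using (Bool; T; if_then_else_; not)
open import Data.Fin.Base as Fin using (Fin; zero; suc; toℕ)
import Data.Fin.Properties as Fin
open import Data.Fin.Subset using (Subset)
import Data.Fin.Subset as Subset
open import Data.Nat.Base as ℕ using (ℕ; zero; suc)
open import Data.Product.Base using (∃; ∃-syntax; _×_)
open import Data.Vec.Base using (tabulate)
open import Data.Vec.Functional using (Vector; removeAt)
open import Level using (0ℓ)
open import Relation.Binary.Construct.Closure.ReflexiveTransitive using (Star)
open import Relation.Binary.Core using (Rel)
open import Relation.Binary.Definitions using (Symmetric)
open import Relation.Binary.PropositionalEquality.Core using (_≡_)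
open import Relation.Binary.Structures using (IsDecTotalOrder)
open import Relation.Nullary.Decidable.Core using (does)
open import Relation.Nullary.Negation.Core using (¬_)
open import Relation.Unary using (Pred)

-- The real numbers, axiomatised classically as a Dedekind-complete totally
-- ordered field (unique up to isomorphism).  The value of 0# ⁻¹ is left
-- unspecified.
record CompleteOrderedField : Set₁ where
  infix  4 _≤_
  infix  8 _⁻¹
  field
    commutativeRing : CommutativeRing 0ℓ 0ℓ
  open CommutativeRing commutativeRing public hiding (zero)
  field
    _⁻¹             : Op₁ Carrier
    _≤_             : Rel Carrier 0ℓ
    0≉1             : ¬ (0# ≈ 1#)
    ⁻¹-cong         : ∀ {x y} → x ≈ y → x ⁻¹ ≈ y ⁻¹
    ⁻¹-inverseʳ     : ∀ {x} → ¬ (x ≈ 0#) → x * x ⁻¹ ≈ 1#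
    isDecTotalOrder : IsDecTotalOrder _≈_ _≤_
    +-monoˡ-≤       : ∀ {x y} z → x ≤ y → x + z ≤ y + z
    *-nonneg        : ∀ {x y} → 0# ≤ x → 0# ≤ y → 0# ≤ x * y

  UpperBound : Pred Carrier 0ℓ → Carrier → Set
  UpperBound P b = ∀ x → P x → x ≤ b

  field
    supremum : (P : Pred Carrier 0ℓ) → ∃ P → ∃ (UpperBound P) →
               ∃[ s ] UpperBound P s × (∀ b → UpperBound P b → s ≤ b)

  open IsDecTotalOrder isDecTotalOrder public using (_≟_; _≤?_)

record Graph (n : ℕ) : Set where
  field
    adj : Fin n → Fin n → Bool

  Adj : Rel (Fin n) 0ℓ
  Adj u v = T (adj u v)

  field
    symmetric : Symmetric Adj
    loopless  : ∀ v → ¬ Adj v v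

  degree : Fin n → ℕ
  degree v = Subset.∣ tabulate (adj v) ∣

  Regular : ℕ → Set
  Regular d = ∀ v → degree v ≡ d

  Connected : Set
  Connected = ∀ u v → Star Adj u v

module Real (ℝ : CompleteOrderedField) where
  open CompleteOrderedField ℝ
  open RawSemiringDefs (Semiring.rawSemiring semiring) public
    using (sum; product; _^_)
    renaming (_×_ to _·ℕ_)

  fromℕ : ℕ → Carrier
  fromℕ m = m ·ℕ 1#

  ∣_∣ : Op₁ Carrier
  ∣ x ∣ = if does (0# ≤? x) then x else - x

  Matrix : ℕ → Set
  Matrix n = Fin n → Fin n → Carrier

  diagonal : ∀ {n} → Vector Carrier n → Matrix n
  diagonal x i j = if does (i Fin.≟ j) then x i else 0#

  infixl 7 _⊗_ _⊗ᵥ_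

  _⊗_ : ∀ {n} → Matrix n → Matrix n → Matrix n
  (M ⊗ N) i j = sum λ k → M i k * N k j

  _⊗ᵥ_ : ∀ {n} → Matrix n → Vector Carrier n → Vector Carrier n
  (M ⊗ᵥ x) i = sum λ j → M i j * x j

  -- Laplace expansion along the first row.
  det : ∀ {n} → Matrix n → Carrier
  det {zero}  M = 1#
  det {suc n} M =
    sum λ j → (- 1#) ^ toℕ j * (M zero j * det (λ i → removeAt (M (suc i)) j))

  charPoly : ∀ {n} → Matrix n → Carrier → Carrier
  charPoly M x = det (λ i j → diagonal (λ _ → x) i j - M i j)

  -- ev lists the roots of the characteristic polynomial with multiplicity.
  -- Since an ordered field is infinite, equality of the two polynomial
  -- functions is equality of polynomials.
  IsSpectrum : ∀ {n} → Matrix n → Vector Carrier n → Set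
  IsSpectrum M ev = ∀ x → charPoly M x ≈ product (λ i → x - ev i)

  DecreasingAbs : ∀ {n} → Vector Carrier n → Set
  DecreasingAbs ev = ∀ i j → i Fin.≤ j → ∣ ev j ∣ ≤ ∣ ev i ∣

  module _ {n : ℕ} where

    IsProbability : Vector Carrier n → Set
    IsProbability μ = (∀ v → 0# ≤ μ v) × sum μ ≈ 1#

    support : Vector Carrier n → Subset n
    support μ = tabulate λ v → not (does (μ v ≟ 0#))

    adjacency : Graph n → Matrix n
    adjacency G u v = if Graph.adj G u v then 1# else 0#

    AD⁻¹ : Graph n → Matrix n
    AD⁻¹ G = adjacency G ⊗ diagonal (λ v → fromℕ (Graph.degree G v) ⁻¹)

    walk : Graph n → Vector Carrier n → ℕ → Vector Carrier n
    walk G μ₀ zero    = μ₀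
    walk G μ₀ (suc k) = AD⁻¹ G ⊗ᵥ walk G μ₀ k

module Submission where

open import Defs
open import Data.Fin.Base using (Fin; toℕ; fromℕ<)
open import Data.Fin.Subset using () renaming (∣_∣ to card)
open import Data.Nat.Base as ℕ using (ℕ)
open import Data.Product.Base using (∃-syntax; _×_)
open import Data.Vec.Functional using (Vector)
open import Relation.Binary.PropositionalEquality.Core using (_≡_)

open import Algebra.Bundles using (Semiring)
open import Data.Bool.Base using (Bool; T; true; false; not; if_then_else_)
open import Data.Fin.Base as Fin using (zero; suc; inject₁; punchIn; punchOut)
import Data.Fin.Properties as Fin
import Data.Fin.Subset.Properties as Subset
open import Data.Integer.Base as ℤ using (ℤ; +_; -[1+_])
import Data.Integer.Properties as ℤ
open import Data.Maybe.Base using (Maybe; just; nothing)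
open import Data.Nat.Base using (zero; suc)
import Data.Nat.Properties as ℕ
open import Data.Product.Base using (_,_; proj₁; proj₂)
open import Data.Sum.Base using (_⊎_; inj₁; inj₂; [_,_]′)
import Data.Vec.Base as Vec
open import Data.Vec.Functional using (removeAt; updateAt; insertAt; head; tail; _∷_)
open import Data.Vec.Functional.Properties
  using (updateAt-updates; updateAt-minimal; insertAt-lookup; insertAt-punchIn)
import Data.Vec.Properties as Vec
open import Function.Base using (_∘_; id; const)
open import Relation.Binary.Construct.Closure.ReflexiveTransitive using (ε; _◅_)
open import Relation.Binary.PropositionalEquality.Core as ≡ using (_≢_)
open import Relation.Binary.Structures using (IsDecTotalOrder)
open import Relation.Nullary using (¬_; yes; no; does; contradiction)
open import Relation.Nullary.Decidable using (¬?; decidable-stable)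

-- The eigenvalue 1 has the constant eigenvector.  By Carathéodory's argument the
-- uniform measure can be replaced by a measure μ₀ on at most ℓ vertices with the
-- same inner products with the first ℓ eigenvectors.  Then μ₀ - 1/n is orthogonal
-- to these, so by Parseval each step of the walk shrinks its norm by |λ_{ℓ+1}|,
-- and initially the norm is at most 1.
--
-- The eigenbasis comes out of the characteristic polynomial by deflation: if v
-- is an eigenvector for a, the shift M + c v vᵀ moves the root a to a value τ
-- outside the spectrum and keeps the other roots, and eigenvectors of the shifted
-- matrix for roots other than τ are orthogonal to v, hence eigenvectors of M.

-- The eigenvalues are given only as roots of `charPoly` with multiplicity, so the obstacle is to
-- find as many orthogonal eigenvectors as a repeated root demands. After a shift the old
-- eigenvector cannot turn up again: it now belongs to τ, and symmetry makes eigenvectors for every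
-- other value orthogonal to it. The shifted matrix has the same size, so no orthogonal complement
-- has to be coordinatised. Since each `ev i` is at most `ev zero` = 1 in absolute value, τ = 2
-- serves for all shifts. What remains is how `charPoly` changes under a shift, which follows from
-- Cramer's rule and column operations. The deflation starts at the constant vector, so the first of
-- the ℓ inner products is the total mass. That `μ₀` is a probability measure is therefore one of
-- the ℓ conditions, and ℓ vertices suffice instead of ℓ + 1. Eigenvectors are never normalised,
-- which avoids square roots.

module _ (ℝ : CompleteOrderedField) where
  open CompleteOrderedField ℝ
  open Real ℝ
  open IsDecTotalOrder isDecTotalOrder
    using (total; antisym; ≤-respˡ-≈; ≤-respʳ-≈)
    renaming (refl to ≤-refl; trans to ≤-trans; reflexive to ≤-reflexive)
  open import Algebra.Definitions.RawSemiring (Semiring.rawSemiring semiring) using (_×′_)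
  open import Algebra.Properties.AbelianGroup +-abelianGroup using (⁻¹-∙-comm)
  open import Algebra.Properties.Ring ring using (-0#≈0#; -‿involutive; -‿distribˡ-*; -‿distribʳ-*)
  import Algebra.Properties.Semiring.Mult.TCOptimised semiring as Mult
  open import Algebra.Properties.Semiring.Sum semiring
    using (sum-replicate-zero; ∑-comm; ∑-distrib-+; *-distribˡ-sum; *-distribʳ-sum; sum-remove)
    renaming (sum-cong-≋ to sum-cong)
  import Algebra.Solver.Ring
  open import Algebra.Solver.Ring.AlmostCommutativeRing using (fromCommutativeRing; _-Raw-AlmostCommutative⟶_)
  open import Relation.Binary.Reasoning.Setoid setoid

  -- Ordered field arithmetic

  private
    -- Integer coefficients let the ring solver compare constants by computation. With `_×′_` the
    -- image of 1 is `1#` by definition, so `0:` and `1:` read back as `0#` and `1#`.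
    fromℤ : ℤ → Carrier
    fromℤ (+ n)    = n ×′ 1#
    fromℤ -[1+ n ] = - (suc n ×′ 1#)

    fromℤ-⊖ : ∀ m n → fromℤ (m ℤ.⊖ n) ≈ m ×′ 1# + - (n ×′ 1#)
    fromℤ-⊖ m       zero    = sym (trans (+-congˡ -0#≈0#) (+-identityʳ _))
    fromℤ-⊖ zero    (suc n) = sym (+-identityˡ _)
    fromℤ-⊖ (suc m) (suc n) = begin
      fromℤ (suc m ℤ.⊖ suc n)                    ≡⟨ ≡.cong fromℤ (ℤ.[1+m]⊖[1+n]≡m⊖n m n) ⟩
      fromℤ (m ℤ.⊖ n)                            ≈⟨ fromℤ-⊖ m n ⟩
      a + - b                                    ≈⟨ +-congʳ (+-identityˡ a) ⟨
      0# + a + - b                               ≈⟨ +-congʳ (+-congʳ (-‿inverseʳ 1#)) ⟨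
      1# + - 1# + a + - b
        ≈⟨ +-congʳ (trans (+-assoc _ _ _) (trans (+-congˡ (+-comm _ _)) (sym (+-assoc _ _ _)))) ⟩
      1# + a + - 1# + - b                        ≈⟨ +-assoc _ _ _ ⟩
      1# + a + (- 1# + - b)                      ≈⟨ +-congˡ (⁻¹-∙-comm 1# b) ⟩
      1# + a + - (1# + b)                        ≈⟨ +-cong (Mult.1+× m 1#) (-‿cong (Mult.1+× n 1#)) ⟨
      suc m ×′ 1# + - (suc n ×′ 1#)              ∎
      where a = m ×′ 1#
            b = n ×′ 1#

    fromℤ-neg : ∀ i → fromℤ (ℤ.- i) ≈ - fromℤ i
    fromℤ-neg (+ zero)   = sym -0#≈0#
    fromℤ-neg (+ suc n)  = refl
    fromℤ-neg -[1+ n ]   = sym (-‿involutive _)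

    fromℤ-+ : ∀ i j → fromℤ (i ℤ.+ j) ≈ fromℤ i + fromℤ j
    fromℤ-+ (+ m)    (+ n)    = Mult.×-homo-+ 1# m n
    fromℤ-+ (+ m)    -[1+ n ] = fromℤ-⊖ m (suc n)
    fromℤ-+ -[1+ m ] (+ n)    = trans (fromℤ-⊖ n (suc m)) (+-comm _ _)
    fromℤ-+ -[1+ m ] -[1+ n ] = begin
      - (suc (suc (m ℕ.+ n)) ×′ 1#)          ≡⟨ ≡.cong (λ k → - (suc k ×′ 1#)) (≡.sym (ℕ.+-suc m n)) ⟩
      - ((suc m ℕ.+ suc n) ×′ 1#)            ≈⟨ -‿cong (Mult.×-homo-+ 1# (suc m) (suc n)) ⟩
      - (suc m ×′ 1# + suc n ×′ 1#)          ≈⟨ ⁻¹-∙-comm _ _ ⟨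
      - (suc m ×′ 1#) + - (suc n ×′ 1#)      ∎

    fromℤ-*⁺ : ∀ m j → fromℤ (+ m ℤ.* j) ≈ m ×′ 1# * fromℤ j
    fromℤ-*⁺ m (+ n) = trans (reflexive (≡.cong fromℤ (≡.sym (ℤ.pos-* m n)))) (Mult.×1-homo-* m n)
    fromℤ-*⁺ m -[1+ n ] = begin
      fromℤ (+ m ℤ.* ℤ.- (+ suc n))        ≡⟨ ≡.cong fromℤ (ℤ.neg-distribʳ-* (+ m) (+ suc n)) ⟨
      fromℤ (ℤ.- (+ m ℤ.* + suc n))        ≈⟨ fromℤ-neg (+ m ℤ.* + suc n) ⟩
      - fromℤ (+ m ℤ.* + suc n)            ≈⟨ -‿cong (fromℤ-*⁺ m (+ suc n)) ⟩
      - (m ×′ 1# * suc n ×′ 1#)            ≈⟨ -‿distribʳ-* _ _ ⟩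
      m ×′ 1# * - (suc n ×′ 1#)            ∎

    fromℤ-* : ∀ i j → fromℤ (i ℤ.* j) ≈ fromℤ i * fromℤ j
    fromℤ-* (+ m) j = fromℤ-*⁺ m j
    fromℤ-* -[1+ m ] j = begin
      fromℤ (ℤ.- (+ suc m) ℤ.* j)          ≡⟨ ≡.cong fromℤ (ℤ.neg-distribˡ-* (+ suc m) j) ⟨
      fromℤ (ℤ.- (+ suc m ℤ.* j))          ≈⟨ fromℤ-neg (+ suc m ℤ.* j) ⟩
      - fromℤ (+ suc m ℤ.* j)              ≈⟨ -‿cong (fromℤ-*⁺ (suc m) j) ⟩
      - (suc m ×′ 1# * fromℤ j)            ≈⟨ -‿distribˡ-* _ _ ⟩
      - (suc m ×′ 1#) * fromℤ j            ∎

    fromℤ-≟ : ∀ i j → Maybe (fromℤ i ≈ fromℤ j)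
    fromℤ-≟ i j with i ℤ.≟ j
    ... | yes i≡j = just (reflexive (≡.cong fromℤ i≡j))
    ... | no _    = nothing

    fromℤ-morphism : ℤ.+-*-rawRing -Raw-AlmostCommutative⟶ fromCommutativeRing commutativeRing
    fromℤ-morphism = record
      { ⟦_⟧ = fromℤ ; +-homo = fromℤ-+ ; *-homo = fromℤ-* ; -‿homo = fromℤ-neg
      ; 0-homo = refl ; 1-homo = refl }

  module Solver =
    Algebra.Solver.Ring ℤ.+-*-rawRing (fromCommutativeRing commutativeRing) fromℤ-morphism fromℤ-≟

  open Solver using (solve; _:=_; _:+_; _:*_; _:-_; :-_; con)

  0: 1: : ∀ {n} → Solver.Polynomial n
  0: = con (+ 0)
  1: = con (+ 1)

  -- The usual route to an inequality below: a visibly nonnegative form `z` of the difference, with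
  -- the ring identity left to the solver.
  ≤-by : ∀ {x y z} → 0# ≤ z → y - x ≈ z → x ≤ y
  ≤-by {x} {y} {z} 0≤z y-x≈z = ≤-respˡ-≈ (+-identityˡ x) (≤-respʳ-≈ (begin
    z + x      ≈⟨ +-congʳ y-x≈z ⟨
    y - x + x  ≈⟨ solve 2 (λ x y → y :- x :+ x := y) refl x y ⟩
    y          ∎) (+-monoˡ-≤ x 0≤z))

  x≤y⇒0≤y-x : ∀ {x y} → x ≤ y → 0# ≤ y - x
  x≤y⇒0≤y-x {x} x≤y = ≤-respˡ-≈ (-‿inverseʳ x) (+-monoˡ-≤ (- x) x≤y)

  +-nonneg : ∀ {x y} → 0# ≤ x → 0# ≤ y → 0# ≤ x + y
  +-nonneg {x} {y} 0≤x 0≤y = ≤-trans 0≤y (≤-respˡ-≈ (+-identityˡ y) (+-monoˡ-≤ y 0≤x))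

  +-mono-≤ : ∀ {w x y z} → w ≤ x → y ≤ z → w + y ≤ x + z
  +-mono-≤ {w} {x} {y} {z} w≤x y≤z = ≤-by (+-nonneg (x≤y⇒0≤y-x w≤x) (x≤y⇒0≤y-x y≤z))
    (solve 4 (λ w x y z → x :+ z :- (w :+ y) := x :- w :+ (z :- y)) refl w x y z)

  *-monoˡ-≤ : ∀ {x y z} → 0# ≤ z → x ≤ y → z * x ≤ z * y
  *-monoˡ-≤ {x} {y} {z} 0≤z x≤y = ≤-by (*-nonneg 0≤z (x≤y⇒0≤y-x x≤y))
    (solve 3 (λ x y z → z :* y :- z :* x := z :* (y :- x)) refl x y z)

  *-monoʳ-≤ : ∀ {x y z} → 0# ≤ z → x ≤ y → x * z ≤ y * z
  *-monoʳ-≤ {x} {y} {z} 0≤z x≤y = ≤-respˡ-≈ (*-comm z x) (≤-respʳ-≈ (*-comm z y) (*-monoˡ-≤ 0≤z x≤y))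

  neg-nonneg : ∀ {x} → x ≤ 0# → 0# ≤ - x
  neg-nonneg {x} x≤0 = ≤-respʳ-≈ (+-identityˡ (- x)) (x≤y⇒0≤y-x x≤0)

  x²-nonneg : ∀ x → 0# ≤ x * x
  x²-nonneg x with total 0# x
  ... | inj₁ 0≤x = *-nonneg 0≤x 0≤x
  ... | inj₂ x≤0 = ≤-respʳ-≈ (solve 1 (λ x → :- x :* :- x := x :* x) refl x)
                     (*-nonneg (neg-nonneg x≤0) (neg-nonneg x≤0))

  0≤1 : 0# ≤ 1#
  0≤1 = ≤-respʳ-≈ (*-identityˡ 1#) (x²-nonneg 1#)

  1≰0 : ¬ (1# ≤ 0#)
  1≰0 1≤0 = 0≉1 (antisym 0≤1 1≤0)

  ⁻¹-inverseˡ : ∀ {x} → ¬ (x ≈ 0#) → x ⁻¹ * x ≈ 1#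
  ⁻¹-inverseˡ x≉0 = trans (*-comm _ _) (⁻¹-inverseʳ x≉0)

  ⁻¹-nonneg : ∀ {x} → 0# ≤ x → ¬ (x ≈ 0#) → 0# ≤ x ⁻¹
  ⁻¹-nonneg {x} 0≤x x≉0 = ≤-respʳ-≈ (begin
    x * (x ⁻¹ * x ⁻¹)  ≈⟨ *-assoc x _ _ ⟨
    x * x ⁻¹ * x ⁻¹    ≈⟨ *-congʳ (⁻¹-inverseʳ x≉0) ⟩
    1# * x ⁻¹          ≈⟨ *-identityˡ _ ⟩
    x ⁻¹               ∎) (*-nonneg 0≤x (x²-nonneg (x ⁻¹)))

  *-cancelˡ : ∀ {x y z} → ¬ (x ≈ 0#) → x * y ≈ x * z → y ≈ z
  *-cancelˡ {x} {y} {z} x≉0 xy≈xz = begin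
    y                ≈⟨ lemma y ⟨
    x ⁻¹ * (x * y)   ≈⟨ *-congˡ xy≈xz ⟩
    x ⁻¹ * (x * z)   ≈⟨ lemma z ⟩
    z                ∎
    where
    lemma : ∀ y → x ⁻¹ * (x * y) ≈ y
    lemma y = trans (sym (*-assoc _ _ _)) (trans (*-congʳ (⁻¹-inverseˡ x≉0)) (*-identityˡ y))

  *≈0⇒≈0 : ∀ {x y} → ¬ (x ≈ 0#) → x * y ≈ 0# → y ≈ 0#
  *≈0⇒≈0 {x} x≉0 xy≈0 = *-cancelˡ x≉0 (trans xy≈0 (sym (zeroʳ x)))

  *-cancelˡ-≤ : ∀ {x y z} → 0# ≤ x → ¬ (x ≈ 0#) → x * y ≤ x * z → y ≤ z
  *-cancelˡ-≤ {x} {y} {z} 0≤x x≉0 xy≤xz =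
    ≤-respˡ-≈ (lemma y) (≤-respʳ-≈ (lemma z) (*-monoˡ-≤ (⁻¹-nonneg 0≤x x≉0) xy≤xz))
    where
    lemma : ∀ y → x ⁻¹ * (x * y) ≈ y
    lemma y = trans (sym (*-assoc _ _ _)) (trans (*-congʳ (⁻¹-inverseˡ x≉0)) (*-identityˡ y))

  x*x≈0⇒x≈0 : ∀ {x} → x * x ≈ 0# → x ≈ 0#
  x*x≈0⇒x≈0 {x} xx≈0 with x ≟ 0#
  ... | yes x≈0 = x≈0
  ... | no  x≉0 = *≈0⇒≈0 x≉0 xx≈0

  x-y≈0⇒x≈y : ∀ {x y} → x - y ≈ 0# → x ≈ y
  x-y≈0⇒x≈y {x} {y} eq = begin
    x            ≈⟨ solve 2 (λ x y → x := x :- y :+ y) refl x y ⟩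
    x - y + y    ≈⟨ +-congʳ eq ⟩
    0# + y       ≈⟨ +-identityˡ y ⟩
    y            ∎

  x≈y⇒x-y≈0 : ∀ {x y} → x ≈ y → x - y ≈ 0#
  x≈y⇒x-y≈0 {x} {y} eq = trans (+-congʳ eq) (-‿inverseʳ y)

  sum-zero : ∀ {n} {f : Vector Carrier n} → (∀ i → f i ≈ 0#) → sum f ≈ 0#
  sum-zero {n} f≈0 = trans (sum-cong f≈0) (sum-replicate-zero n)

  sum-single : ∀ {n} (f : Vector Carrier n) p → (∀ i → i ≢ p → f i ≈ 0#) → sum f ≈ f p
  sum-single f zero    f≈0 = trans (+-congˡ (sum-zero (λ i → f≈0 (suc i) λ ()))) (+-identityʳ _)
  sum-single f (suc p) f≈0 = trans
    (+-cong (f≈0 zero λ ()) (sum-single (f ∘ suc) p (λ i i≢p → f≈0 (suc i) (i≢p ∘ Fin.suc-injective))))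
    (+-identityˡ _)

  sum-mono-≤ : ∀ {n} {f g : Vector Carrier n} → (∀ i → f i ≤ g i) → sum f ≤ sum g
  sum-mono-≤ {zero}  f≤g = ≤-refl
  sum-mono-≤ {suc n} f≤g = +-mono-≤ (f≤g zero) (sum-mono-≤ (f≤g ∘ suc))

  sum-nonneg : ∀ {n} {f : Vector Carrier n} → (∀ i → 0# ≤ f i) → 0# ≤ sum f
  sum-nonneg {n} 0≤f = ≤-respˡ-≈ (sum-replicate-zero n) (sum-mono-≤ 0≤f)

  term≤sum : ∀ {n} {f : Vector Carrier n} → (∀ i → 0# ≤ f i) → ∀ j → f j ≤ sum f
  term≤sum {f = f} 0≤f zero    = ≤-respˡ-≈ (+-identityʳ _) (+-mono-≤ ≤-refl (sum-nonneg (0≤f ∘ suc)))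
  term≤sum {f = f} 0≤f (suc j) = ≤-respˡ-≈ (+-identityˡ _) (+-mono-≤ (0≤f zero) (term≤sum (0≤f ∘ suc) j))

  sum-sub : ∀ {n} (f g : Vector Carrier n) → sum (λ i → f i - g i) ≈ sum f - sum g
  sum-sub {zero}  f g = sym (-‿inverseʳ 0#)
  sum-sub {suc n} f g = trans (+-congˡ (sum-sub (f ∘ suc) (g ∘ suc)))
    (solve 4 (λ a b c d → a :- b :+ (c :- d) := a :+ c :- (b :+ d)) refl _ _ _ _)

  -- Dot products

  infix 8 _·_
  _·_ : ∀ {n} → Vector Carrier n → Vector Carrier n → Carrier
  x · y = sum λ i → x i * y i

  ·-cong : ∀ {n} {x x′ y y′ : Vector Carrier n} → (∀ i → x i ≈ x′ i) → (∀ i → y i ≈ y′ i) → x · y ≈ x′ · y′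
  ·-cong x≈x′ y≈y′ = sum-cong λ i → *-cong (x≈x′ i) (y≈y′ i)

  ·-comm : ∀ {n} (x y : Vector Carrier n) → x · y ≈ y · x
  ·-comm x y = sum-cong λ i → *-comm (x i) (y i)

  ·-distribˡ-+* : ∀ {n} (x y z : Vector Carrier n) c → x · (λ i → y i + c * z i) ≈ x · y + c * x · z
  ·-distribˡ-+* x y z c = begin
    x · (λ i → y i + c * z i)
      ≈⟨ sum-cong (λ i → solve 4 (λ x y z c → x :* (y :+ c :* z) := x :* y :+ c :* (x :* z)) refl (x i) (y i) (z i) c) ⟩
    sum (λ i → x i * y i + c * (x i * z i))    ≈⟨ ∑-distrib-+ (λ i → x i * y i) (λ i → c * (x i * z i)) ⟩
    x · y + sum (λ i → c * (x i * z i))        ≈⟨ +-congˡ (*-distribˡ-sum c (λ i → x i * z i)) ⟨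
    x · y + c * x · z                          ∎

  Nonzero : ∀ {n} → Vector Carrier n → Set
  Nonzero x = ∃[ j ] ¬ (x j ≈ 0#)

  x·x-nonneg : ∀ {n} (x : Vector Carrier n) → 0# ≤ x · x
  x·x-nonneg x = sum-nonneg λ i → x²-nonneg (x i)

  x·x≈0⇒x≈0 : ∀ {n} (x : Vector Carrier n) → x · x ≈ 0# → ∀ j → x j ≈ 0#
  x·x≈0⇒x≈0 x xx≈0 j = x*x≈0⇒x≈0 (antisym
    (≤-respʳ-≈ xx≈0 (term≤sum (λ i → x²-nonneg (x i)) j)) (x²-nonneg (x j)))

  nonzero⇒x·x≉0 : ∀ {n} (x : Vector Carrier n) → Nonzero x → ¬ (x · x ≈ 0#)
  nonzero⇒x·x≉0 x (j , xj≉0) xx≈0 = xj≉0 (x·x≈0⇒x≈0 x xx≈0 j)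

  -- Determinants

  minor : ∀ {n} → Matrix (suc n) → Fin (suc n) → Matrix n
  minor A j i = removeAt (A (suc i)) j

  det-cong : ∀ {n} {A B : Matrix n} → (∀ i j → A i j ≈ B i j) → det A ≈ det B
  det-cong {zero}  A≈B = refl
  det-cong {suc n} A≈B = sum-cong λ j →
    *-congˡ {x = (- 1#) ^ toℕ j} (*-cong (A≈B zero j) (det-cong λ i k → A≈B (suc i) (punchIn j k)))

  -- In the Laplace term for column `p` the first-row entry is linear and the minors agree; in any
  -- other term the entry is common and the minor is linear by induction. One combined form yields
  -- additivity, homogeneity and the vanishing at a zero column.
  det-linear : ∀ {n} p a {A B C : Matrix n} →
               (∀ i → A i p ≈ a * B i p + C i p) →
               (∀ i j → j ≢ p → A i j ≈ B i j) → (∀ i j → j ≢ p → A i j ≈ C i j) →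
               det A ≈ a * det B + det C
  det-linear {suc n} p a {A} {B} {C} Ap A≈B A≈C = begin
    sum (λ j → s j * (A zero j * det (minor A j)))
      ≈⟨ sum-cong term ⟩
    sum (λ j → a * (s j * (B zero j * det (minor B j))) + s j * (C zero j * det (minor C j)))
      ≈⟨ ∑-distrib-+ (λ j → a * (s j * (B zero j * det (minor B j)))) (λ j → s j * (C zero j * det (minor C j))) ⟩
    sum (λ j → a * (s j * (B zero j * det (minor B j)))) + det C
      ≈⟨ +-congʳ (*-distribˡ-sum a (λ j → s j * (B zero j * det (minor B j)))) ⟨
    a * det B + det C ∎
    where
    s : Fin (suc n) → Carrier
    s j = (- 1#) ^ toℕ j
    term : ∀ j → s j * (A zero j * det (minor A j)) ≈
                 a * (s j * (B zero j * det (minor B j))) + s j * (C zero j * det (minor C j))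
    term j with j Fin.≟ p
    ... | yes ≡.refl = begin
      s j * (A zero j * det (minor A j))
        ≈⟨ *-congˡ (*-congʳ (Ap zero)) ⟩
      s j * ((a * B zero j + C zero j) * det (minor A j))
        ≈⟨ solve 5 (λ s a b c d → s :* ((a :* b :+ c) :* d) := a :* (s :* (b :* d)) :+ s :* (c :* d)) refl _ _ _ _ _ ⟩
      a * (s j * (B zero j * det (minor A j))) + s j * (C zero j * det (minor A j))
        ≈⟨ +-cong (*-congˡ (*-congˡ (*-congˡ (det-cong λ i k → A≈B (suc i) _ (Fin.punchInᵢ≢i j k)))))
                  (*-congˡ (*-congˡ (det-cong λ i k → A≈C (suc i) _ (Fin.punchInᵢ≢i j k)))) ⟩
      _ ∎
    ... | no j≢p = begin
      s j * (A zero j * det (minor A j))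
        ≈⟨ *-congˡ (*-congˡ (det-linear p′ a {B = minor B j} {C = minor C j}
             (λ i → at-p (λ q → A (suc i) q ≈ a * B (suc i) q + C (suc i) q) (Ap (suc i)))
             (λ i k k≢p′ → A≈B (suc i) _ (off-p k k≢p′)) (λ i k k≢p′ → A≈C (suc i) _ (off-p k k≢p′)))) ⟩
      s j * (A zero j * (a * det (minor B j) + det (minor C j)))
        ≈⟨ solve 5 (λ s x a b c → s :* (x :* (a :* b :+ c)) := a :* (s :* (x :* b)) :+ s :* (x :* c)) refl _ _ _ _ _ ⟩
      a * (s j * (A zero j * det (minor B j))) + s j * (A zero j * det (minor C j))
        ≈⟨ +-cong (*-congˡ (*-congˡ (*-congʳ (A≈B zero j j≢p)))) (*-congˡ (*-congʳ (A≈C zero j j≢p))) ⟩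
      _ ∎
      where
      p′ = punchOut j≢p
      at-p : (P : Fin (suc n) → Set) → P p → P (punchIn j p′)
      at-p P = ≡.subst P (≡.sym (Fin.punchIn-punchOut j≢p))
      off-p : ∀ k → k ≢ p′ → punchIn j k ≢ p
      off-p k k≢p′ eq = k≢p′ (Fin.punchIn-injective j k p′ (≡.trans eq (≡.sym (Fin.punchIn-punchOut j≢p))))

  sum-adjacent : ∀ {n} (j : Fin n) (f : Vector Carrier (suc n)) → f (inject₁ j) + f (suc j) ≈ 0# →
                 (∀ l → l ≢ inject₁ j → l ≢ suc j → f l ≈ 0#) → sum f ≈ 0#
  sum-adjacent zero f eq rest = begin
    f zero + (f (suc zero) + sum (λ i → f (suc (suc i))))   ≈⟨ +-assoc _ _ _ ⟨
    f zero + f (suc zero) + sum (λ i → f (suc (suc i)))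
      ≈⟨ +-cong eq (sum-zero λ i → rest (suc (suc i)) (λ ()) (λ ())) ⟩
    0# + 0#                                                 ≈⟨ +-identityˡ 0# ⟩
    0#                                                      ∎
  sum-adjacent (suc j) f eq rest = trans
    (+-cong (rest zero (λ ()) (λ ()))
      (sum-adjacent j (f ∘ suc) eq λ l l≢j l≢1+j → rest (suc l) (l≢j ∘ Fin.suc-injective) (l≢1+j ∘ Fin.suc-injective)))
    (+-identityˡ 0#)

  -- Neighbouring columns stay neighbours when a third column is deleted, which keeps the induction
  -- in `det-adjacent` going.
  punchIn-adjacent : ∀ {n} (l : Fin (suc (suc n))) (j : Fin (suc n)) → l ≢ inject₁ j → l ≢ suc j →
                     ∃[ j′ ] punchIn l (inject₁ j′) ≡ inject₁ j × punchIn l (suc {n} j′) ≡ suc j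
  punchIn-adjacent zero    zero    l≢j _ = contradiction ≡.refl l≢j
  punchIn-adjacent zero    (suc j) _   _ = j , ≡.refl , ≡.refl
  punchIn-adjacent {suc n} (suc zero)    zero    _ l≢1+j = contradiction ≡.refl l≢1+j
  punchIn-adjacent {suc n} (suc (suc l)) zero    _ _     = zero , ≡.refl , ≡.refl
  punchIn-adjacent {suc n} (suc l) (suc j) l≢j l≢1+j
    with j′ , eq₁ , eq₂ ← punchIn-adjacent l j (l≢j ∘ ≡.cong suc) (l≢1+j ∘ ≡.cong suc)
    = suc j′ , ≡.cong suc eq₁ , ≡.cong suc eq₂
  punchIn-adjacent {zero}  (suc zero) zero _ l≢1+j = contradiction ≡.refl l≢1+j

  -- Deleting one or the other of two neighbouring columns gives the same list, except at the one
  -- place where the surviving neighbour stands. If the two columns are equal, the minors coincide.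
  punchIn-inject₁-suc : ∀ {n} (j k : Fin n) → punchIn (inject₁ j) k ≡ punchIn (suc j) k ⊎
                        (punchIn (inject₁ j) k ≡ suc j × punchIn (suc j) k ≡ inject₁ j)
  punchIn-inject₁-suc zero    zero    = inj₂ (≡.refl , ≡.refl)
  punchIn-inject₁-suc zero    (suc k) = inj₁ ≡.refl
  punchIn-inject₁-suc (suc j) zero    = inj₁ ≡.refl
  punchIn-inject₁-suc (suc j) (suc k) with punchIn-inject₁-suc j k
  ... | inj₁ eq          = inj₁ (≡.cong suc eq)
  ... | inj₂ (eq₁ , eq₂) = inj₂ (≡.cong suc eq₁ , ≡.cong suc eq₂)

  -- In the Laplace expansion the terms of the two equal columns have equal entries and minors but
  -- opposite signs. Every other minor again has two equal adjacent columns.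
  det-adjacent : ∀ {n} (j : Fin n) (A : Matrix (suc n)) →
                 (∀ i → A i (inject₁ j) ≈ A i (suc j)) → det A ≈ 0#
  det-adjacent {suc n} j A eq = sum-adjacent j _ cancel vanish
    where
    term : Fin (suc (suc n)) → Carrier
    term l = (- 1#) ^ toℕ l * (A zero l * det (minor A l))
    same-minor : ∀ i k → minor A (inject₁ j) i k ≈ minor A (suc j) i k
    same-minor i k with punchIn-inject₁-suc j k
    ... | inj₁ p       = reflexive (≡.cong (A (suc i)) p)
    ... | inj₂ (p , q) = begin
      A (suc i) (punchIn (inject₁ j) k)   ≡⟨ ≡.cong (A (suc i)) p ⟩
      A (suc i) (suc j)                   ≈⟨ eq (suc i) ⟨
      A (suc i) (inject₁ j)               ≡⟨ ≡.cong (A (suc i)) q ⟨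
      A (suc i) (punchIn (suc j) k)       ∎
    cancel : term (inject₁ j) + term (suc j) ≈ 0#
    cancel = begin
      term (inject₁ j) + term (suc j)
        ≈⟨ +-congʳ (*-cong (reflexive (≡.cong ((- 1#) ^_) (Fin.toℕ-inject₁ j)))
                           (*-cong (eq zero) (det-cong same-minor))) ⟩
      (- 1#) ^ toℕ j * (A zero (suc j) * det (minor A (suc j))) + term (suc j)
        ≈⟨ solve 2 (λ s x → s :* x :+ (:- 1: :* s) :* x := 0:) refl _ _ ⟩
      0# ∎
    vanish : ∀ l → l ≢ inject₁ j → l ≢ suc j → term l ≈ 0#
    vanish l l≢j l≢1+j with j′ , p , q ← punchIn-adjacent l j l≢j l≢1+j = begin
      (- 1#) ^ toℕ l * (A zero l * det (minor A l))
        ≈⟨ *-congˡ (*-congˡ (det-adjacent j′ (minor A l) λ i →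
             trans (reflexive (≡.cong (A (suc i)) p)) (trans (eq (suc i)) (reflexive (≡.cong (A (suc i)) (≡.sym q)))))) ⟩
      (- 1#) ^ toℕ l * (A zero l * 0#)
        ≈⟨ solve 2 (λ s x → s :* (x :* 0:) := 0:) refl _ _ ⟩
      0# ∎

  abstract
    -- Kept abstract so that goals do not unfold `updateAt`; only the two lookup laws are used
    -- afterwards.
    setCol : ∀ {n} → Matrix n → Fin n → Vector Carrier n → Matrix n
    setCol A p w i = updateAt (A i) p (const (w i))

    setCol-at : ∀ {n} (A : Matrix n) p w i → setCol A p w i p ≈ w i
    setCol-at A p w i = reflexive (updateAt-updates p (A i))

    setCol-off : ∀ {n} (A : Matrix n) p w i {j} → j ≢ p → setCol A p w i j ≈ A i j
    setCol-off A p w i j≢p = reflexive (updateAt-minimal _ p (A i) j≢p)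

  module _ {n} (A : Matrix n) {p b : Fin n} (p≢b : p ≢ b) where
    setCol₂ : Vector Carrier n → Vector Carrier n → Matrix n
    setCol₂ x y = setCol (setCol A b y) p x

    setCol₂-p : ∀ x y i → setCol₂ x y i p ≈ x i
    setCol₂-p x y = setCol-at (setCol A b y) p x

    setCol₂-b : ∀ x y i → setCol₂ x y i b ≈ y i
    setCol₂-b x y i = trans (setCol-off (setCol A b y) p x i (p≢b ∘ ≡.sym)) (setCol-at A b y i)

    setCol₂-off : ∀ x y i {j} → j ≢ p → j ≢ b → setCol₂ x y i j ≈ A i j
    setCol₂-off x y i j≢p j≢b = trans (setCol-off (setCol A b y) p x i j≢p) (setCol-off A b y i j≢b)

  private
    -- Induction on the position of `b`. Let `p` be the column just before `b`, and let D x y carry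
    -- x at `p` and y at `b`. Then D (x+y) (x+y) vanishes by adjacency and splits into D x x, D x y
    -- and D y (x+y). The first vanishes by adjacency. The last has equal columns `a` and `p`, so it
    -- vanishes by induction. What is left, D x y, is `A` itself.
    det-alternating-< : ∀ m {n} (a b : Fin n) → toℕ b ≡ m → a Fin.< b → (A : Matrix n) →
                        (∀ i → A i a ≈ A i b) → det A ≈ 0#
    det-alternating-< (suc m) {suc n} a (suc k) b≡m a<b A eq with a Fin.≟ inject₁ k
    ... | yes ≡.refl = det-adjacent k A eq
    ... | no  a≢p    = begin
      det A                          ≈⟨ det-cong restore ⟨
      det (D x y)                    ≈⟨ +-identityˡ _ ⟨
      0# + det (D x y)               ≈⟨ +-congʳ (zeroʳ 1#) ⟨
      1# * 0# + det (D x y)          ≈⟨ +-congʳ (*-congˡ (adjacent x)) ⟨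
      1# * det (D x x) + det (D x y) ≈⟨ det-linear b 1# {D x x+y} {D x x} {D x y}
                                          (λ i → trans (at-b x x+y i) (sym (+-cong (trans (*-identityˡ _) (at-b x x i)) (at-b x y i))))
                                          (λ i j j≢b → same-p x i j j≢b) (λ i j j≢b → same-p x i j j≢b) ⟨
      det (D x x+y)                  ≈⟨ *-identityˡ _ ⟨
      1# * det (D x x+y)             ≈⟨ +-identityʳ _ ⟨
      1# * det (D x x+y) + 0#        ≈⟨ +-congˡ (det-alternating-< m a p p≡m a<p (D y x+y)
                                          (λ i → trans (off y x+y i a≢p a≢b) (trans (eq i) (sym (at-p y x+y i))))) ⟨
      1# * det (D x x+y) + det (D y x+y) ≈⟨ det-linear p 1# {D x+y x+y} {D x x+y} {D y x+y}
                                          (λ i → trans (at-p x+y x+y i) (sym (+-cong (trans (*-identityˡ _) (at-p x x+y i)) (at-p y x+y i))))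
                                          (λ i j j≢p → same-b x+y i j j≢p) (λ i j j≢p → same-b x+y i j j≢p) ⟨
      det (D x+y x+y)                ≈⟨ adjacent x+y ⟩
      0#                             ∎
      where
      p b : Fin (suc n)
      p = inject₁ k
      b = suc k
      p≡m : toℕ p ≡ m
      p≡m = ≡.trans (Fin.toℕ-inject₁ k) (ℕ.suc-injective b≡m)
      a<p : a Fin.< p
      a<p = ℕ.≤∧≢⇒< (≡.subst (toℕ a ℕ.≤_) (≡.sym (Fin.toℕ-inject₁ k)) (ℕ.s≤s⁻¹ a<b)) (a≢p ∘ Fin.toℕ-injective)
      a≢b : a ≢ b
      a≢b ≡.refl = ℕ.<-irrefl ≡.refl a<b
      p≢b : p ≢ b
      p≢b p≡b = ℕ.<-irrefl (≡.trans (≡.sym (Fin.toℕ-inject₁ k)) (≡.cong toℕ p≡b)) ℕ.≤-refl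
      x y x+y : Vector Carrier (suc n)
      x i = A i p
      y i = A i b
      x+y i = x i + y i
      D = setCol₂ A p≢b
      at-p = setCol₂-p A p≢b
      at-b = setCol₂-b A p≢b
      off = setCol₂-off A p≢b
      adjacent : ∀ z → det (D z z) ≈ 0#
      adjacent z = det-adjacent k (D z z) λ i → trans (at-p z z i) (sym (at-b z z i))
      restore : ∀ i j → D x y i j ≈ A i j
      restore i j with j Fin.≟ p | j Fin.≟ b
      ... | yes ≡.refl | _          = at-p x y i
      ... | no _       | yes ≡.refl = at-b x y i
      ... | no j≢p     | no j≢b     = off x y i j≢p j≢b
      same-p : ∀ z {u v} i j → j ≢ b → D z u i j ≈ D z v i j
      same-p z {u} {v} i j j≢b with j Fin.≟ p
      ... | yes ≡.refl = trans (at-p z u i) (sym (at-p z v i))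
      ... | no j≢p     = trans (off z u i j≢p j≢b) (sym (off z v i j≢p j≢b))
      same-b : ∀ z {u v} i j → j ≢ p → D u z i j ≈ D v z i j
      same-b z {u} {v} i j j≢p with j Fin.≟ b
      ... | yes ≡.refl = trans (at-b u z i) (sym (at-b v z i))
      ... | no j≢b     = trans (off u z i j≢p j≢b) (sym (off v z i j≢p j≢b))

  det-alternating : ∀ {n} {a b : Fin n} → a ≢ b → (A : Matrix n) → (∀ i → A i a ≈ A i b) → det A ≈ 0#
  det-alternating {a = a} {b} a≢b A eq with ℕ.≤-total (toℕ a) (toℕ b)
  ... | inj₁ a≤b = det-alternating-< _ a b ≡.refl (ℕ.≤∧≢⇒< a≤b (a≢b ∘ Fin.toℕ-injective)) A eq
  ... | inj₂ b≤a = det-alternating-< _ b a ≡.refl (ℕ.≤∧≢⇒< b≤a (a≢b ∘ ≡.sym ∘ Fin.toℕ-injective)) A (sym ∘ eq)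

  -- Replacing one column: linearity, Cramer's rule, rank-one changes

  det-setCol-linear : ∀ {n} (A : Matrix n) p a (x y : Vector Carrier n) →
                      det (setCol A p (λ i → a * x i + y i)) ≈ a * det (setCol A p x) + det (setCol A p y)
  det-setCol-linear A p a x y = det-linear p a
    (λ i → trans (setCol-at A p _ i) (sym (+-cong (*-congˡ (setCol-at A p x i)) (setCol-at A p y i))))
    (λ i j j≢p → trans (setCol-off A p _ i j≢p) (sym (setCol-off A p x i j≢p)))
    (λ i j j≢p → trans (setCol-off A p _ i j≢p) (sym (setCol-off A p y i j≢p)))

  setCol-cong : ∀ {n} (A : Matrix n) p {x y : Vector Carrier n} → (∀ i → x i ≈ y i) →
                ∀ i j → setCol A p x i j ≈ setCol A p y i j
  setCol-cong A p {x} {y} x≈y i j with j Fin.≟ p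
  ... | yes ≡.refl = trans (setCol-at A p x i) (trans (x≈y i) (sym (setCol-at A p y i)))
  ... | no j≢p     = trans (setCol-off A p x i j≢p) (sym (setCol-off A p y i j≢p))

  det-setCol-zero : ∀ {n} (A : Matrix n) p → det (setCol A p (λ _ → 0#)) ≈ 0#
  det-setCol-zero A p = begin
    d                              ≈⟨ solve 1 (λ d → d := 1: :* d :+ d :- d) refl d ⟩
    1# * d + d - d                 ≈⟨ +-congʳ (det-setCol-linear A p 1# _ _) ⟨
    det (setCol A p (λ _ → 1# * 0# + 0#)) - d
      ≈⟨ +-congʳ (det-cong (setCol-cong A p λ _ → solve 0 (1: :* 0: :+ 0: := 0:) refl)) ⟩
    d - d                          ≈⟨ -‿inverseʳ d ⟩
    0#                             ∎
    where d = det (setCol A p (λ _ → 0#))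

  det-setCol-sum : ∀ {m n} (A : Matrix n) p (c : Vector Carrier m) (w : Fin m → Vector Carrier n) →
                   det (setCol A p (λ i → sum λ j → c j * w j i)) ≈ sum (λ j → c j * det (setCol A p (w j)))
  det-setCol-sum {zero}  A p c w = det-setCol-zero A p
  det-setCol-sum {suc m} A p c w = trans (det-setCol-linear A p (c zero) (w zero) _)
    (+-congˡ (det-setCol-sum A p (c ∘ suc) (w ∘ suc)))

  -- The inserted column is a combination of the columns of `A`; every summand except that of column
  -- `p` repeats a column already present.
  cramer-rule : ∀ {n} (A : Matrix n) p (v : Vector Carrier n) →
                  det (setCol A p (A ⊗ᵥ v)) ≈ v p * det A
  cramer-rule A p v = begin
    det (setCol A p (A ⊗ᵥ v))
      ≈⟨ det-cong (setCol-cong A p λ i → sum-cong λ j → *-comm (A i j) (v j)) ⟩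
    det (setCol A p (λ i → sum λ j → v j * A i j))
      ≈⟨ det-setCol-sum A p v (λ j i → A i j) ⟩
    sum (λ j → v j * det (setCol A p (λ i → A i j)))
      ≈⟨ sum-single _ p (λ j j≢p → trans (*-congˡ (det-alternating j≢p _ λ i →
           trans (setCol-off A p _ i j≢p) (sym (setCol-at A p _ i)))) (zeroʳ (v j))) ⟩
    v p * det (setCol A p (λ i → A i p))
      ≈⟨ *-congˡ (det-cong restore) ⟩
    v p * det A ∎
    where
    restore : ∀ i j → setCol A p (λ i → A i p) i j ≈ A i j
    restore i j with j Fin.≟ p
    ... | yes ≡.refl = setCol-at A p _ i
    ... | no j≢p     = setCol-off A p _ i j≢p

  -- Each vector arises from zero by filling in entries one at a time, which turns a simultaneous
  -- column operation into a chain of single ones. `P` has to respect pointwise equality because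
  -- vectors are functions.
  update-induction : ∀ {n} (P : Vector Carrier n → Set) → (∀ {y z} → (∀ i → y i ≈ z i) → P y → P z) →
                     P (λ _ → 0#) →
                     (∀ z s c → z s ≈ 0# → P z → P (updateAt z s (const c))) → ∀ z → P z
  update-induction {zero}  P resp base step z = resp (λ ()) base
  update-induction {suc n} P resp base step z = resp at-head
    (step (0# ∷ tail z) zero (head z) refl
      (update-induction (λ y → P (0# ∷ y)) (λ y≈z → resp (λ { zero → refl ; (suc i) → y≈z i }))
        (resp (λ { zero → refl ; (suc i) → refl }) base)
        (λ y s c ys≈0 Py → resp (λ { zero → refl ; (suc i) → refl }) (step (0# ∷ y) (suc s) c ys≈0 Py))
        (tail z)))
    where
    at-head : ∀ i → updateAt (0# ∷ tail z) zero (const (head z)) i ≈ z i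
    at-head zero    = refl
    at-head (suc i) = refl

  -- Column operations: multiples of column s (here w) are added to the other columns.
  det-setCol-rank₁ : ∀ {n} (A : Matrix n) s (w z : Vector Carrier n) →
                     det (setCol (λ i j → A i j + w i * z j) s w) ≈ det (setCol A s w)
  det-setCol-rank₁ {n} A s w = update-induction P
    (λ y≈z Py → trans (det-cong (at-off _ _ λ i j _ → +-congˡ (*-congˡ (sym (y≈z j))))) Py)
    (det-cong (at-off _ _ λ i j _ → trans (+-congˡ (zeroʳ (w i))) (+-identityʳ _)))
    step
    where
    B : Vector Carrier n → Matrix n
    B z i j = A i j + w i * z j
    P : Vector Carrier n → Set
    P z = det (setCol (B z) s w) ≈ det (setCol A s w)
    at-off : ∀ (C D : Matrix n) → (∀ i j → j ≢ s → C i j ≈ D i j) → ∀ i j → setCol C s w i j ≈ setCol D s w i j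
    at-off C D C≈D i j with j Fin.≟ s
    ... | yes ≡.refl = trans (setCol-at C s w i) (sym (setCol-at D s w i))
    ... | no j≢s     = trans (setCol-off C s w i j≢s) (trans (C≈D i j j≢s) (sym (setCol-off D s w i j≢s)))
    step : ∀ z t c → z t ≈ 0# → P z → P (updateAt z t (const c))
    step z t c zt≈0 Pz with t Fin.≟ s
    ... | yes ≡.refl = trans (det-cong (at-off (B z′) (B z) λ i j j≢s →
            +-congˡ (*-congˡ (reflexive (updateAt-minimal j t z j≢s))))) Pz
      where z′ = updateAt z t (const c)
    ... | no t≢s = begin
      det (setCol (B z′) s w)                 ≈⟨ det-linear t c {setCol (B z′) s w} {E} {setCol (B z) s w}
                                                   at-t (λ i j j≢t → trans (off i j j≢t) (sym (setCol-off _ t w i j≢t))) off ⟩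
      c * det E + det (setCol (B z) s w)      ≈⟨ +-cong (*-congˡ (det-alternating t≢s E λ i →
                                                   trans (setCol-at _ t w i) (sym (trans (setCol-off _ t w i (t≢s ∘ ≡.sym)) (setCol-at (B z) s w i))))) Pz ⟩
      c * 0# + det (setCol A s w)             ≈⟨ trans (+-congʳ (zeroʳ c)) (+-identityˡ _) ⟩
      det (setCol A s w)                      ∎
      where
      z′ = updateAt z t (const c)
      E : Matrix n
      E = setCol (setCol (B z) s w) t w
      at-t : ∀ i → setCol (B z′) s w i t ≈ c * E i t + setCol (B z) s w i t
      at-t i = begin
        setCol (B z′) s w i t                   ≈⟨ setCol-off (B z′) s w i t≢s ⟩
        A i t + w i * z′ t                      ≡⟨ ≡.cong (λ c → A i t + w i * c) (updateAt-updates t z) ⟩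
        A i t + w i * c
          ≈⟨ solve 3 (λ a w c → a :+ w :* c := c :* w :+ (a :+ w :* 0:)) refl _ _ _ ⟩
        c * w i + (A i t + w i * 0#)
          ≈⟨ +-cong (*-congˡ (setCol-at _ t w i)) (+-congˡ (*-congˡ zt≈0)) ⟨
        c * E i t + (A i t + w i * z t)         ≈⟨ +-congˡ (setCol-off (B z) s w i t≢s) ⟨
        c * E i t + setCol (B z) s w i t        ∎
      off : ∀ i j → j ≢ t → setCol (B z′) s w i j ≈ setCol (B z) s w i j
      off i j j≢t with j Fin.≟ s
      ... | yes ≡.refl = trans (setCol-at (B z′) s w i) (sym (setCol-at (B z) s w i))
      ... | no j≢s     = begin
        setCol (B z′) s w i j     ≈⟨ setCol-off (B z′) s w i j≢s ⟩
        A i j + w i * z′ j        ≡⟨ ≡.cong (λ c → A i j + w i * c) (updateAt-minimal j t z j≢t) ⟩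
        A i j + w i * z j         ≈⟨ setCol-off (B z) s w i j≢s ⟨
        setCol (B z) s w i j      ∎

  -- Linear systems

  -- A Gaussian elimination step by columns: multiples of the pivot column clear the first row. As a
  -- rank-one change of the matrix, it serves both the kernel and, through `det-setCol-rank₁`, the
  -- determinant.
  module Elimination {m n} (A : Fin (suc m) → Vector Carrier (suc n)) (p : Fin (suc n)) (pivot : ¬ (A zero p ≈ 0#)) where
    multiplier : Vector Carrier (suc n)
    multiplier j = - (A zero p ⁻¹ * A zero j)

    reduced : Fin m → Vector Carrier n
    reduced i k = A (suc i) (punchIn p k) + A (suc i) p * multiplier (punchIn p k)

    first-row : ∀ j → A zero j + A zero p * multiplier j ≈ 0#
    first-row j = begin
      a + b * - (b ⁻¹ * a)
        ≈⟨ solve 3 (λ a b c → a :+ b :* :- (c :* a) := a :- b :* c :* a) refl a b (b ⁻¹) ⟩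
      a - b * b ⁻¹ * a        ≈⟨ +-congˡ (-‿cong (trans (*-congʳ (⁻¹-inverseʳ pivot)) (*-identityˡ a))) ⟩
      a - a                   ≈⟨ -‿inverseʳ a ⟩
      0#                      ∎
      where a = A zero j
            b = A zero p

    back-substitute : ∀ {y} → Nonzero y → (∀ i → reduced i · y ≈ 0#) → ∃[ x ] Nonzero x × (∀ i → A i · x ≈ 0#)
    back-substitute {y} (j , yj≉0) Ry≈0 = x , (punchIn p j , yj≉0 ∘ trans (sym (x-punchIn j))) , Ax≈0
      where
      c : Carrier
      -- The value of the pivot unknown forced by the first equation.
      c = sum λ k → multiplier (punchIn p k) * y k
      x : Vector Carrier (suc n)
      x = insertAt y p c
      x-punchIn : ∀ k → x (punchIn p k) ≈ y k
      x-punchIn k = reflexive (insertAt-punchIn y p c k)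
      split : ∀ i → A i · x ≈ sum (λ k → (A i (punchIn p k) + A i p * multiplier (punchIn p k)) * y k)
      split i = begin
        A i · x
          ≈⟨ sum-remove {i = p} (λ j → A i j * x j) ⟩
        A i p * x p + sum (λ k → A i (punchIn p k) * x (punchIn p k))
          ≈⟨ +-cong (*-congˡ (reflexive (insertAt-lookup y p c))) (sum-cong λ k → *-congˡ (x-punchIn k)) ⟩
        A i p * c + sum (λ k → A i (punchIn p k) * y k)
          ≈⟨ +-congʳ (*-distribˡ-sum (A i p) (λ k → multiplier (punchIn p k) * y k)) ⟩
        sum (λ k → A i p * (multiplier (punchIn p k) * y k)) + sum (λ k → A i (punchIn p k) * y k)
          ≈⟨ ∑-distrib-+ (λ k → A i p * (multiplier (punchIn p k) * y k)) (λ k → A i (punchIn p k) * y k) ⟨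
        sum (λ k → A i p * (multiplier (punchIn p k) * y k) + A i (punchIn p k) * y k)
          ≈⟨ sum-cong (λ k → solve 4 (λ a z y b → a :* (z :* y) :+ b :* y := (b :+ a :* z) :* y) refl
               (A i p) (multiplier (punchIn p k)) (y k) (A i (punchIn p k))) ⟩
        sum (λ k → (A i (punchIn p k) + A i p * multiplier (punchIn p k)) * y k) ∎
      Ax≈0 : ∀ i → A i · x ≈ 0#
      Ax≈0 zero    = trans (split zero) (sum-zero λ k → trans (*-congʳ (first-row (punchIn p k))) (zeroˡ (y k)))
      Ax≈0 (suc i) = trans (split (suc i)) (Ry≈0 i)

  pivot? : ∀ {n} (x : Vector Carrier n) → Nonzero x ⊎ (∀ j → x j ≈ 0#)
  pivot? x with Fin.any? (λ j → ¬? (x j ≟ 0#))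
  ... | yes x≉0 = inj₁ x≉0
  ... | no  x≈0 = inj₂ λ j → decidable-stable (x j ≟ 0#) λ xj≉0 → x≈0 (j , xj≉0)

  ·-zeroˡ : ∀ {n} {x : Vector Carrier n} → (∀ j → x j ≈ 0#) → ∀ y → x · y ≈ 0#
  ·-zeroˡ x≈0 y = sum-zero λ j → trans (*-congʳ (x≈0 j)) (zeroˡ (y j))

  -- Each step uses up one equation and at most one unknown, so an unknown is left when the
  -- equations run out; then any nonzero vector will do.
  underdetermined : ∀ {m n} → m ℕ.≤ n → (A : Fin m → Vector Carrier (suc n)) →
                    ∃[ x ] Nonzero x × (∀ i → A i · x ≈ 0#)
  underdetermined ℕ.z≤n A = (λ _ → 1#) , (zero , 0≉1 ∘ sym) , λ ()
  underdetermined (ℕ.s≤s m≤n) A with pivot? (A zero)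
  ... | inj₁ (p , A₀p≉0) with y , y≉0 , Ry≈0 ← underdetermined m≤n (Elimination.reduced A p A₀p≉0)
    = Elimination.back-substitute A p A₀p≉0 y≉0 Ry≈0
  ... | inj₂ A₀≈0 with x , x≉0 , Ax≈0 ← underdetermined (ℕ.m≤n⇒m≤1+n m≤n) (A ∘ suc)
    = x , x≉0 , λ { zero → ·-zeroˡ A₀≈0 x ; (suc i) → Ax≈0 i }

  sign*x≈0⇒x≈0 : ∀ k {x} → (- 1#) ^ k * x ≈ 0# → x ≈ 0#
  sign*x≈0⇒x≈0 zero    {x} eq = trans (sym (*-identityˡ x)) eq
  sign*x≈0⇒x≈0 (suc k) {x} eq = sign*x≈0⇒x≈0 k (begin
    (- 1#) ^ k * x                   ≈⟨ solve 2 (λ s x → s :* x := :- (:- 1: :* s :* x)) refl _ _ ⟩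
    - ((- 1#) * (- 1#) ^ k * x)      ≈⟨ -‿cong eq ⟩
    - 0#                             ≈⟨ solve 0 (:- 0: := 0:) refl ⟩
    0#                               ∎)

  -- Once the column operations have cleared the first row outside `p`, a single Laplace term
  -- survives.
  det-reduced : ∀ {n} (A : Matrix (suc n)) p (A₀p≉0 : ¬ (A zero p ≈ 0#)) →
                det A ≈ (- 1#) ^ toℕ p * (A zero p * det (Elimination.reduced A p A₀p≉0))
  det-reduced {n} A p A₀p≉0 = begin
    det A                      ≈⟨ det-cong restore ⟨
    det (setCol A p w)         ≈⟨ det-setCol-rank₁ A p w multiplier ⟨
    det B
      ≈⟨ sum-single (λ j → (- 1#) ^ toℕ j * (B zero j * det (minor B j))) p vanish ⟩
    (- 1#) ^ toℕ p * (B zero p * det (minor B p))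
      ≈⟨ *-congˡ (*-cong (setCol-at _ p w zero) (det-cong λ i k → setCol-off _ p w (suc i) (Fin.punchInᵢ≢i p k))) ⟩
    (- 1#) ^ toℕ p * (A zero p * det reduced) ∎
    where
    open Elimination A p A₀p≉0
    w : Vector Carrier (suc n)
    w i = A i p
    B : Matrix (suc n)
    B = setCol (λ i j → A i j + w i * multiplier j) p w
    vanish : ∀ j → j ≢ p → (- 1#) ^ toℕ j * (B zero j * det (minor B j)) ≈ 0#
    vanish j j≢p = begin
      (- 1#) ^ toℕ j * (B zero j * det (minor B j))
        ≈⟨ *-congˡ (*-congʳ (trans (setCol-off _ p w zero j≢p) (first-row j))) ⟩
      (- 1#) ^ toℕ j * (0# * det (minor B j))
        ≈⟨ solve 2 (λ s d → s :* (0: :* d) := 0:) refl _ _ ⟩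
      0# ∎
    restore : ∀ i j → setCol A p w i j ≈ A i j
    restore i j with j Fin.≟ p
    ... | yes ≡.refl = setCol-at A p w i
    ... | no j≢p     = setCol-off A p w i j≢p

  det≈0⇒kernel : ∀ {n} (A : Matrix n) → det A ≈ 0# → ∃[ x ] Nonzero x × (∀ i → (A ⊗ᵥ x) i ≈ 0#)
  det≈0⇒kernel {zero}  A detA≈0 = contradiction (sym detA≈0) 0≉1
  det≈0⇒kernel {suc n} A detA≈0 with pivot? (A zero)
  ... | inj₁ (p , A₀p≉0) with y , y≉0 , Ry≈0 ← det≈0⇒kernel (Elimination.reduced A p A₀p≉0)
            (*≈0⇒≈0 A₀p≉0 (sign*x≈0⇒x≈0 (toℕ p) (trans (sym (det-reduced A p A₀p≉0)) detA≈0)))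
    = Elimination.back-substitute A p A₀p≉0 y≉0 Ry≈0
  ... | inj₂ A₀≈0 with x , x≉0 , Ax≈0 ← underdetermined ℕ.≤-refl (A ∘ suc)
    = x , x≉0 , λ { zero → ·-zeroˡ A₀≈0 x ; (suc i) → Ax≈0 i }

  det-setCol-scale : ∀ {n} (A : Matrix n) p a (x : Vector Carrier n) →
                     det (setCol A p (λ i → a * x i)) ≈ a * det (setCol A p x)
  det-setCol-scale A p a x = begin
    det (setCol A p (λ i → a * x i))
      ≈⟨ det-cong (setCol-cong A p λ i → sym (+-identityʳ _)) ⟩
    det (setCol A p (λ i → a * x i + 0#))                        ≈⟨ det-setCol-linear A p a x (λ _ → 0#) ⟩
    a * det (setCol A p x) + det (setCol A p (λ _ → 0#))         ≈⟨ +-congˡ (det-setCol-zero A p) ⟩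
    a * det (setCol A p x) + 0#                                  ≈⟨ +-identityʳ _ ⟩
    a * det (setCol A p x)                                       ∎

  -- The matrix determinant lemma for an eigenvector, multiplied out so that neither `A` nor `α` has
  -- to be invertible. `v` is an eigenvector of both matrices, so Cramer's rule expresses both
  -- determinants through the one with column `p` replaced by `v`, and there the rank-one change is
  -- invisible.
  det-rank₁-eigenvector : ∀ {n} (A : Matrix n) (v : Vector Carrier n) α c → Nonzero v →
                          (∀ i → (A ⊗ᵥ v) i ≈ α * v i) →
                          α * det (λ i j → A i j + v i * (c * v j)) ≈ (α + c * v · v) * det A
  det-rank₁-eigenvector {n} A v α c (p , vp≉0) Av≈αv = *-cancelˡ vp≉0 (begin
    v p * (α * det B)                ≈⟨ solve 3 (λ v a d → v :* (a :* d) := a :* (v :* d)) refl _ _ _ ⟩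
    α * (v p * det B)                ≈⟨ *-congˡ (v-column B β Bv≈βv) ⟩
    α * (β * det (setCol B p v))     ≈⟨ *-congˡ (*-congˡ (det-setCol-rank₁ A p v (λ j → c * v j))) ⟩
    α * (β * det (setCol A p v))     ≈⟨ solve 3 (λ v a d → v :* (a :* d) := a :* (v :* d)) refl _ _ _ ⟩
    β * (α * det (setCol A p v))     ≈⟨ *-congˡ (v-column A α Av≈αv) ⟨
    β * (v p * det A)                ≈⟨ solve 3 (λ v a d → v :* (a :* d) := a :* (v :* d)) refl _ _ _ ⟩
    v p * (β * det A)                ∎)
    where
    β : Carrier
    β = α + c * v · v
    B : Matrix n
    B i j = A i j + v i * (c * v j)
    Bv≈βv : ∀ i → (B ⊗ᵥ v) i ≈ β * v i
    Bv≈βv i = begin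
      (B ⊗ᵥ v) i
        ≈⟨ sum-cong (λ j → solve 4 (λ a w c v → (a :+ w :* (c :* v)) :* v := v :* (a :+ w :* c :* v)) refl (A i j) (v i) c (v j)) ⟩
      v · (λ j → A i j + v i * c * v j)                  ≈⟨ ·-distribˡ-+* v (A i) v (v i * c) ⟩
      v · A i + v i * c * v · v                          ≈⟨ +-congʳ (·-comm v (A i)) ⟩
      (A ⊗ᵥ v) i + v i * c * v · v                       ≈⟨ +-congʳ (Av≈αv i) ⟩
      α * v i + v i * c * v · v
        ≈⟨ solve 4 (λ a w c v → a :* w :+ w :* c :* v := (a :+ c :* v) :* w) refl _ _ _ _ ⟩
      β * v i                                            ∎
    v-column : ∀ (C : Matrix n) γ → (∀ i → (C ⊗ᵥ v) i ≈ γ * v i) → v p * det C ≈ γ * det (setCol C p v)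
    v-column C γ Cv≈γv = begin
      v p * det C                            ≈⟨ cramer-rule C p v ⟨
      det (setCol C p (C ⊗ᵥ v))              ≈⟨ det-cong (setCol-cong C p Cv≈γv) ⟩
      det (setCol C p (λ i → γ * v i))       ≈⟨ det-setCol-scale C p γ v ⟩
      γ * det (setCol C p v)                 ∎

  -- Continuity of polynomials

  -- One-sided Lipschitz continuity on [a, a + 1], squared to avoid absolute values.
  Lipschitz : (Carrier → Carrier) → Set
  Lipschitz f = ∀ a → ∃[ B ] ∀ t → 0# ≤ t → t ≤ 1# → (f (a + t) - f a) * (f (a + t) - f a) ≤ t * t * B

  lipschitz-bound-nonneg : ∀ {f} (L : Lipschitz f) a → 0# ≤ proj₁ (L a)
  lipschitz-bound-nonneg L a with B , L′ ← L a =
    ≤-respʳ-≈ (solve 1 (λ b → 1: :* 1: :* b := b) refl B) (≤-trans (x²-nonneg _) (L′ 1# 0≤1 ≤-refl))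

  -- Takes the place of the triangle inequality in the squared estimates.
  [x+y]²≤2[x²+y²] : ∀ x y → (x + y) * (x + y) ≤ (1# + 1#) * (x * x + y * y)
  [x+y]²≤2[x²+y²] x y = ≤-by (x²-nonneg (x - y))
    (solve 2 (λ x y → (1: :+ 1:) :* (x :* x :+ y :* y) :- (x :+ y) :* (x :+ y) := (x :- y) :* (x :- y)) refl x y)

  0≤2 : 0# ≤ 1# + 1#
  0≤2 = +-nonneg 0≤1 0≤1

  t²≤1 : ∀ {t} → 0# ≤ t → t ≤ 1# → t * t ≤ 1#
  t²≤1 {t} 0≤t t≤1 = ≤-trans (≤-respʳ-≈ (*-identityʳ t) (*-monoˡ-≤ 0≤t t≤1)) t≤1

  lipschitz-const : ∀ c → Lipschitz (λ _ → c)
  lipschitz-const c a = 0# , λ t _ _ → ≤-reflexive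
    (solve 2 (λ c t → (c :- c) :* (c :- c) := t :* t :* 0:) refl c t)

  lipschitz-id : Lipschitz id
  lipschitz-id a = 1# , λ t _ _ → ≤-reflexive
    (solve 2 (λ a t → (a :+ t :- a) :* (a :+ t :- a) := t :* t :* 1:) refl a t)

  lipschitz-+ : ∀ {f g} → Lipschitz f → Lipschitz g → Lipschitz (λ x → f x + g x)
  lipschitz-+ {f} {g} Lf Lg a with B , Lf′ ← Lf a | C , Lg′ ← Lg a =
    (1# + 1#) * (B + C) , λ t 0≤t t≤1 → let d = f (a + t) - f a; e = g (a + t) - g a in
    ≤-respˡ-≈ (solve 4 (λ f f′ g g′ → (f′ :- f :+ (g′ :- g)) :* (f′ :- f :+ (g′ :- g)) :=
                                      (f′ :+ g′ :- (f :+ g)) :* (f′ :+ g′ :- (f :+ g))) refl _ _ _ _)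
      (≤-respʳ-≈ (solve 3 (λ t b c → (1: :+ 1:) :* (t :* t :* b :+ t :* t :* c) := t :* t :* ((1: :+ 1:) :* (b :+ c))) refl t B C)
        (≤-trans ([x+y]²≤2[x²+y²] d e) (*-monoˡ-≤ 0≤2 (+-mono-≤ (Lf′ t 0≤t t≤1) (Lg′ t 0≤t t≤1)))))

  -- Splits f′g′ - fg as (f′ - f)g′ + f(g′ - g). The factor g′ still depends on t; `K` bounds its
  -- square uniformly for t up to 1.
  lipschitz-* : ∀ {f g} → Lipschitz f → Lipschitz g → Lipschitz (λ x → f x * g x)
  lipschitz-* {f} {g} Lf Lg a with B , Lf′ ← Lf a | C , Lg′ ← Lg a | 0≤B ← lipschitz-bound-nonneg Lf a | 0≤C ← lipschitz-bound-nonneg Lg a =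
    2# * (B * K + f a * f a * C) , bound
    where
    2# K : Carrier
    2# = 1# + 1#
    K = 2# * (g a * g a + C)
    bound : ∀ t → 0# ≤ t → t ≤ 1# →
            (f (a + t) * g (a + t) - f a * g a) * (f (a + t) * g (a + t) - f a * g a) ≤ t * t * (2# * (B * K + f a * f a * C))
    bound t 0≤t t≤1 =
      ≤-respˡ-≈ (solve 4 (λ f f′ g g′ → ((f′ :- f) :* g′ :+ f :* (g′ :- g)) :* ((f′ :- f) :* g′ :+ f :* (g′ :- g)) :=
                                        (f′ :* g′ :- f :* g) :* (f′ :* g′ :- f :* g)) refl (f a) (f (a + t)) (g a) (g (a + t)))
        (≤-respʳ-≈ (solve 5 (λ t b k f c → (1: :+ 1:) :* (t :* t :* b :* k :+ f :* f :* (t :* t :* c)) :=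
                                           t :* t :* ((1: :+ 1:) :* (b :* k :+ f :* f :* c))) refl t B K (f a) C)
          (≤-trans ([x+y]²≤2[x²+y²] (d * g′) (f a * e)) (*-monoˡ-≤ 0≤2 (+-mono-≤ de≤ fe≤))))
      where
      g′ d e : Carrier
      g′ = g (a + t)
      d = f (a + t) - f a
      e = g′ - g a
      e²≤C : e * e ≤ C
      e²≤C = ≤-trans (Lg′ t 0≤t t≤1) (≤-respʳ-≈ (*-identityˡ C) (*-monoʳ-≤ 0≤C (t²≤1 0≤t t≤1)))
      g′²≤K : g′ * g′ ≤ K
      g′²≤K = ≤-respˡ-≈ (solve 2 (λ g g′ → (g :+ (g′ :- g)) :* (g :+ (g′ :- g)) := g′ :* g′) refl (g a) g′)
                (≤-trans ([x+y]²≤2[x²+y²] (g a) e) (*-monoˡ-≤ 0≤2 (+-mono-≤ ≤-refl e²≤C)))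
      de≤ : d * g′ * (d * g′) ≤ t * t * B * K
      de≤ = ≤-respˡ-≈ (solve 2 (λ d g → d :* d :* (g :* g) := d :* g :* (d :* g)) refl d g′)
              (≤-trans (*-monoˡ-≤ (x²-nonneg d) g′²≤K)
                       (*-monoʳ-≤ (≤-trans (x²-nonneg g′) g′²≤K) (Lf′ t 0≤t t≤1)))
      fe≤ : f a * e * (f a * e) ≤ f a * f a * (t * t * C)
      fe≤ = ≤-respˡ-≈ (solve 2 (λ d g → d :* d :* (g :* g) := d :* g :* (d :* g)) refl (f a) e)
              (*-monoˡ-≤ (x²-nonneg (f a)) (Lg′ t 0≤t t≤1))

  lipschitz-resp : ∀ {f g} → (∀ x → f x ≈ g x) → Lipschitz f → Lipschitz g
  lipschitz-resp f≈g Lf a with B , Lf′ ← Lf a = B , λ t 0≤t t≤1 →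
    let eq = +-cong (f≈g (a + t)) (-‿cong (f≈g a)) in ≤-respˡ-≈ (*-cong eq eq) (Lf′ t 0≤t t≤1)

  lipschitz-sub : ∀ {f g} → Lipschitz f → Lipschitz g → Lipschitz (λ x → f x - g x)
  lipschitz-sub {f} {g} Lf Lg = lipschitz-resp (λ x → solve 2 (λ f g → f :+ :- 1: :* g := f :- g) refl (f x) (g x))
    (lipschitz-+ Lf (lipschitz-* (lipschitz-const (- 1#)) Lg))

  lipschitz-sum : ∀ {n} {f : Fin n → Carrier → Carrier} → (∀ j → Lipschitz (f j)) → Lipschitz (λ x → sum λ j → f j x)
  lipschitz-sum {zero}  Lf = lipschitz-const 0#
  lipschitz-sum {suc n} Lf = lipschitz-+ (Lf zero) (lipschitz-sum (Lf ∘ suc))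

  lipschitz-product : ∀ {n} {f : Fin n → Carrier → Carrier} → (∀ j → Lipschitz (f j)) → Lipschitz (λ x → product λ j → f j x)
  lipschitz-product {zero}  Lf = lipschitz-const 1#
  lipschitz-product {suc n} Lf = lipschitz-* (Lf zero) (lipschitz-product (Lf ∘ suc))

  lipschitz-det : ∀ {n} {A : Carrier → Matrix n} → (∀ i j → Lipschitz (λ x → A x i j)) → Lipschitz (λ x → det (A x))
  lipschitz-det {zero}  LA = lipschitz-const 1#
  lipschitz-det {suc n} LA = lipschitz-sum λ j →
    lipschitz-* (lipschitz-const ((- 1#) ^ toℕ j)) (lipschitz-* (LA zero j) (lipschitz-det λ i k → LA (suc i) (punchIn j k)))

  -- If e = f(a)² were nonzero, then e ≤ t²B would fail at t = e/2B.
  lipschitz-vanish : ∀ {f} → Lipschitz f → ∀ a → (∀ t → 0# ≤ t → ¬ (t ≈ 0#) → f (a + t) ≈ 0#) → f a ≈ 0#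
  lipschitz-vanish {f} Lf a f≈0 with f a ≟ 0# | Lf a
  ... | yes fa≈0 | _       = fa≈0
  ... | no  fa≉0 | B , Lf′ = contradiction (antisym B≤0 0≤B) B≉0
    where
    e 2B t : Carrier
    e = f a * f a
    2B = B + B
    t = e * 2B ⁻¹
    e≉0 : ¬ (e ≈ 0#)
    e≉0 = fa≉0 ∘ x*x≈0⇒x≈0
    bound : ∀ t → 0# ≤ t → t ≤ 1# → ¬ (t ≈ 0#) → e ≤ t * t * B
    bound t 0≤t t≤1 t≉0 = ≤-respˡ-≈ (trans (*-cong eq eq) (solve 1 (λ x → (0: :- x) :* (0: :- x) := x :* x) refl (f a))) (Lf′ t 0≤t t≤1)
      where eq = +-congʳ (f≈0 t 0≤t t≉0)
    e≤B : e ≤ B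
    e≤B = ≤-respʳ-≈ (solve 1 (λ b → 1: :* 1: :* b := b) refl B) (bound 1# 0≤1 ≤-refl (0≉1 ∘ sym))
    0≤B : 0# ≤ B
    0≤B = ≤-trans (x²-nonneg _) e≤B
    B≉0 : ¬ (B ≈ 0#)
    B≉0 B≈0 = e≉0 (antisym (≤-respʳ-≈ B≈0 e≤B) (x²-nonneg _))
    B≤2B : B ≤ 2B
    B≤2B = ≤-by 0≤B (solve 1 (λ b → b :+ b :- b := b) refl B)
    0≤2B : 0# ≤ 2B
    0≤2B = +-nonneg 0≤B 0≤B
    2B≉0 : ¬ (2B ≈ 0#)
    2B≉0 2B≈0 = B≉0 (antisym (≤-respʳ-≈ 2B≈0 B≤2B) 0≤B)
    2Bt≈e : 2B * t ≈ e
    2Bt≈e = trans (solve 3 (λ b e i → b :* (e :* i) := e :* (b :* i)) refl 2B e (2B ⁻¹)) (trans (*-congˡ (⁻¹-inverseʳ 2B≉0)) (*-identityʳ e))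
    0≤t : 0# ≤ t
    0≤t = *-nonneg (x²-nonneg _) (⁻¹-nonneg 0≤2B 2B≉0)
    t≉0 : ¬ (t ≈ 0#)
    t≉0 t≈0 = e≉0 (trans (sym 2Bt≈e) (trans (*-congˡ t≈0) (zeroʳ 2B)))
    t≤1 : t ≤ 1#
    t≤1 = *-cancelˡ-≤ 0≤2B 2B≉0 (≤-respˡ-≈ (sym 2Bt≈e) (≤-respʳ-≈ (sym (*-identityʳ 2B)) (≤-trans e≤B B≤2B)))
    4B≤2B : 2B + 2B ≤ 2B
    -- Multiplied by 4B, the bound e ≤ t²B has right side (2Bt)² = e², and cancelling e gives 4B ≤ e
    -- ≤ B.
    4B≤2B = ≤-trans (*-cancelˡ-≤ (x²-nonneg (f a)) e≉0 
      (≤-respʳ-≈ (trans (solve 2 (λ b t → (t :* t :* b) :* ((b :+ b) :+ (b :+ b)) := ((b :+ b) :* t) :* ((b :+ b) :* t)) refl B t) (*-cong 2Bt≈e 2Bt≈e))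
        (*-monoʳ-≤ (+-nonneg 0≤2B 0≤2B) (bound t 0≤t t≤1 t≉0)))) (≤-trans e≤B B≤2B)
    B≤0 : B ≤ 0#
    B≤0 = ≤-trans B≤2B (≤-by (x≤y⇒0≤y-x 4B≤2B) (solve 1 (λ b → 0: :- b := b :- (b :+ b)) refl 2B))

  -- Spectral decomposition

  diagonal-at : ∀ {n} (x : Vector Carrier n) i → diagonal x i i ≈ x i
  diagonal-at x i with i Fin.≟ i
  ... | yes _  = refl
  ... | no i≢i = contradiction ≡.refl i≢i

  diagonal-off : ∀ {n} (x : Vector Carrier n) {i j} → i ≢ j → diagonal x i j ≈ 0#
  diagonal-off x {i} {j} i≢j with i Fin.≟ j
  ... | yes i≡j = contradiction i≡j i≢j
  ... | no _    = refl

  diagonal-⊗ᵥ : ∀ {n} (x v : Vector Carrier n) i → (diagonal x ⊗ᵥ v) i ≈ x i * v i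
  diagonal-⊗ᵥ x v i = trans
    (sum-single (λ j → diagonal x i j * v j) i λ j j≢i → trans (*-congʳ (diagonal-off x (j≢i ∘ ≡.sym))) (zeroˡ (v j)))
    (*-congʳ (diagonal-at x i))

  IsSymmetric : ∀ {n} → Matrix n → Set
  IsSymmetric M = ∀ i j → M i j ≈ M j i

  Eigenvector : ∀ {n} → Matrix n → Carrier → Vector Carrier n → Set
  Eigenvector M λ₀ v = ∀ i → (M ⊗ᵥ v) i ≈ λ₀ * v i

  ·-scaleˡ : ∀ {n} c (x y : Vector Carrier n) → (λ i → c * x i) · y ≈ c * x · y
  ·-scaleˡ c x y = trans (sum-cong λ i → *-assoc c (x i) (y i)) (sym (*-distribˡ-sum c (λ i → x i * y i)))

  ⊗ᵥ-·-adjoint : ∀ {n} {M : Matrix n} → IsSymmetric M → ∀ x y → (M ⊗ᵥ x) · y ≈ x · (M ⊗ᵥ y)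
  ⊗ᵥ-·-adjoint {n} {M} M-sym x y = begin
    sum (λ i → sum (λ j → M i j * x j) * y i)
      ≈⟨ sum-cong (λ i → *-distribʳ-sum (y i) (λ j → M i j * x j)) ⟩
    sum (λ i → sum (λ j → M i j * x j * y i))      ≈⟨ ∑-comm (λ i j → M i j * x j * y i) ⟩
    sum (λ j → sum (λ i → M i j * x j * y i))      ≈⟨ sum-cong (λ j → sum-cong λ i → term i j) ⟩
    sum (λ j → sum (λ i → x j * (M j i * y i)))
      ≈⟨ sum-cong (λ j → *-distribˡ-sum (x j) (λ i → M j i * y i)) ⟨
    x · (M ⊗ᵥ y)                                   ∎
    where
    term : ∀ i j → M i j * x j * y i ≈ x j * (M j i * y i)
    term i j = trans (*-congʳ (*-congʳ (M-sym i j)))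
      (solve 3 (λ m x y → m :* x :* y := x :* (m :* y)) refl (M j i) (x j) (y i))

  eigenvectors-orthogonal : ∀ {n} {M : Matrix n} → IsSymmetric M → ∀ {a b v w} → ¬ (a ≈ b) →
                            Eigenvector M a v → Eigenvector M b w → v · w ≈ 0#
  eigenvectors-orthogonal {M = M} M-sym {a} {b} {v} {w} a≉b Mv Mw =
    *≈0⇒≈0 (a≉b ∘ x-y≈0⇒x≈y) (trans (solve 3 (λ a b d → (a :- b) :* d := a :* d :- b :* d) refl a b (v · w))
      (x≈y⇒x-y≈0 (begin
        a * v · w             ≈⟨ ·-scaleˡ a v w ⟨
        (λ i → a * v i) · w   ≈⟨ ·-cong Mv (λ i → refl {w i}) ⟨
        (M ⊗ᵥ v) · w          ≈⟨ ⊗ᵥ-·-adjoint M-sym v w ⟩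
        v · (M ⊗ᵥ w)          ≈⟨ ·-cong (λ i → refl {v i}) Mw ⟩
        v · (λ i → b * w i)   ≈⟨ ·-comm v _ ⟩
        (λ i → b * w i) · v   ≈⟨ ·-scaleˡ b w v ⟩
        b * w · v             ≈⟨ *-congˡ (·-comm w v) ⟩
        b * v · w             ∎)))

  charMatrix : ∀ {n} → Matrix n → Carrier → Matrix n
  charMatrix M x i j = diagonal (λ _ → x) i j - M i j

  charMatrix-⊗ᵥ : ∀ {n} (M : Matrix n) x v i → (charMatrix M x ⊗ᵥ v) i ≈ x * v i - (M ⊗ᵥ v) i
  charMatrix-⊗ᵥ M x v i = begin
    sum (λ j → (diagonal (λ _ → x) i j - M i j) * v j)
      ≈⟨ sum-cong (λ j → solve 3 (λ d m v → (d :- m) :* v := d :* v :- m :* v) refl (diagonal (λ _ → x) i j) (M i j) (v j)) ⟩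
    sum (λ j → diagonal (λ _ → x) i j * v j - M i j * v j)
      ≈⟨ sum-sub (λ j → diagonal (λ _ → x) i j * v j) (λ j → M i j * v j) ⟩
    (diagonal (λ _ → x) ⊗ᵥ v) i - (M ⊗ᵥ v) i
      ≈⟨ +-congʳ (diagonal-⊗ᵥ (λ _ → x) v i) ⟩
    x * v i - (M ⊗ᵥ v) i ∎

  lipschitz-charPoly : ∀ {n} (M : Matrix n) → Lipschitz (charPoly M)
  lipschitz-charPoly M = lipschitz-det λ i j → lipschitz-sub (entry i j) (lipschitz-const (M i j))
    where
    entry : ∀ i j → Lipschitz (λ x → diagonal (λ _ → x) i j)
    entry i j with i Fin.≟ j
    ... | yes _ = lipschitz-id
    ... | no _  = lipschitz-const 0#

  -- The rank-one shift moves the eigenvalue a of v to τ.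
  module Deflation {n} {M : Matrix n} (M-sym : IsSymmetric M) {v : Vector Carrier n} (v≉0 : Nonzero v)
                   {a : Carrier} (Mv≈av : Eigenvector M a v) (τ : Carrier) where
    c : Carrier
    c = (τ - a) * (v · v) ⁻¹

    c*v·v : c * v · v ≈ τ - a
    c*v·v = trans (*-assoc _ _ _) (trans (*-congˡ (⁻¹-inverseˡ (nonzero⇒x·x≉0 v v≉0))) (*-identityʳ _))

    deflated : Matrix n
    deflated i j = M i j + v i * (c * v j)

    deflated-symmetric : IsSymmetric deflated
    deflated-symmetric i j = +-cong (M-sym i j) (solve 3 (λ x c y → x :* (c :* y) := y :* (c :* x)) refl (v i) c (v j))

    deflated-⊗ᵥ : ∀ w i → (deflated ⊗ᵥ w) i ≈ (M ⊗ᵥ w) i + v i * (c * v · w)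
    deflated-⊗ᵥ w i = begin
      sum (λ j → (M i j + v i * (c * v j)) * w j)
        ≈⟨ sum-cong (λ j → solve 5 (λ m x c y w → (m :+ x :* (c :* y)) :* w := m :* w :+ x :* c :* (y :* w)) refl (M i j) (v i) c (v j) (w j)) ⟩
      sum (λ j → M i j * w j + v i * c * (v j * w j))
        ≈⟨ ∑-distrib-+ (λ j → M i j * w j) (λ j → v i * c * (v j * w j)) ⟩
      (M ⊗ᵥ w) i + sum (λ j → v i * c * (v j * w j))
        ≈⟨ +-congˡ (*-distribˡ-sum (v i * c) (λ j → v j * w j)) ⟨
      (M ⊗ᵥ w) i + v i * c * v · w
        ≈⟨ +-congˡ (*-assoc _ _ _) ⟩
      (M ⊗ᵥ w) i + v i * (c * v · w) ∎

    deflated-eigenvector : Eigenvector deflated τ v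
    deflated-eigenvector i = begin
      (deflated ⊗ᵥ v) i                  ≈⟨ deflated-⊗ᵥ v i ⟩
      (M ⊗ᵥ v) i + v i * (c * v · v)     ≈⟨ +-cong (Mv≈av i) (*-congˡ c*v·v) ⟩
      a * v i + v i * (τ - a)
        ≈⟨ solve 3 (λ a t v → a :* v :+ v :* (t :- a) := t :* v) refl a τ (v i) ⟩
      τ * v i                            ∎

    orthogonal-to-v : ∀ {b w} → ¬ (b ≈ τ) → Eigenvector deflated b w → v · w ≈ 0#
    orthogonal-to-v b≉τ = eigenvectors-orthogonal deflated-symmetric (b≉τ ∘ sym) deflated-eigenvector

    undeflate : ∀ {b w} → ¬ (b ≈ τ) → Eigenvector deflated b w → Eigenvector M b w
    undeflate {b} {w} b≉τ Mw i = begin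
      (M ⊗ᵥ w) i
        ≈⟨ solve 3 (λ m v c → m := m :+ v :* (c :* 0:)) refl ((M ⊗ᵥ w) i) (v i) c ⟩
      (M ⊗ᵥ w) i + v i * (c * 0#)         ≈⟨ +-congˡ (*-congˡ (*-congˡ (orthogonal-to-v b≉τ Mw))) ⟨
      (M ⊗ᵥ w) i + v i * (c * v · w)      ≈⟨ deflated-⊗ᵥ w i ⟨
      (deflated ⊗ᵥ w) i                   ≈⟨ Mw i ⟩
      b * w i                             ∎

    -- `v` is an eigenvector of x - M for the value x - a, and the shift changes that value by -(τ -
    -- a), to x - τ.
    charPoly-relation : ∀ x → (x - a) * charPoly deflated x ≈ (x - τ) * charPoly M x
    charPoly-relation x = begin
      (x - a) * charPoly deflated x
        ≈⟨ *-congˡ (det-cong λ i j → solve 5 (λ d m v c w → d :- (m :+ v :* (c :* w)) := d :- m :+ v :* (:- c :* w)) refl (diagonal (λ _ → x) i j) (M i j) (v i) c (v j)) ⟩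
      (x - a) * det (λ i j → charMatrix M x i j + v i * (- c * v j))
        ≈⟨ det-rank₁-eigenvector (charMatrix M x) v (x - a) (- c) v≉0 eigen ⟩
      (x - a + - c * v · v) * charPoly M x
        ≈⟨ *-congʳ (trans (solve 4 (λ x a c d → x :- a :+ :- c :* d := x :- a :- c :* d) refl x a c (v · v)) (trans (+-congˡ (-‿cong c*v·v))
             (solve 3 (λ x a t → x :- a :- (t :- a) := x :- t) refl x a τ))) ⟩
      (x - τ) * charPoly M x ∎
      where
      eigen : ∀ i → (charMatrix M x ⊗ᵥ v) i ≈ (x - a) * v i
      eigen i = trans (charMatrix-⊗ᵥ M x v i) (trans (+-congˡ (-‿cong (Mv≈av i)))
        (solve 3 (λ x a v → x :* v :- a :* v := (x :- a) :* v) refl x a (v i)))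

    -- The factor x - a is cancelled for x ≉ a, and at x ≈ a by continuity.
    charPoly-deflated : ∀ {q r} → Lipschitz q → Lipschitz r →
                        (∀ x → charPoly M x ≈ q x * ((x - a) * r x)) →
                        ∀ x → charPoly deflated x ≈ (x - τ) * q x * r x
    charPoly-deflated {q} {r} Lq Lr M≈ x = x-y≈0⇒x≈y difference≈0
      where
      f : Carrier → Carrier
      f x = charPoly deflated x - (x - τ) * q x * r x
      Lf : Lipschitz f
      Lf = lipschitz-sub (lipschitz-charPoly deflated)
             (lipschitz-* (lipschitz-* (lipschitz-sub lipschitz-id (lipschitz-const τ)) Lq) Lr)
      away : ∀ x → ¬ (x - a ≈ 0#) → f x ≈ 0#
      away x x≉a = x≈y⇒x-y≈0 (*-cancelˡ x≉a (begin
        (x - a) * charPoly deflated x            ≈⟨ charPoly-relation x ⟩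
        (x - τ) * charPoly M x                   ≈⟨ *-congˡ (M≈ x) ⟩
        (x - τ) * (q x * ((x - a) * r x))
          ≈⟨ solve 4 (λ y q z r → y :* (q :* (z :* r)) := z :* (y :* q :* r)) refl (x - τ) (q x) (x - a) (r x) ⟩
        (x - a) * ((x - τ) * q x * r x)          ∎))
      difference≈0 : f x ≈ 0#
      difference≈0 with x - a ≟ 0#
      ... | no  x≉a = away x x≉a
      ... | yes x≈a = lipschitz-vanish Lf x λ t _ t≉0 → away (x + t) λ x+t≈a → t≉0 (begin
        t                       ≈⟨ solve 3 (λ x a t → t := x :+ t :- a :- (x :- a)) refl x a t ⟩
        x + t - a - (x - a)     ≈⟨ +-cong x+t≈a (-‿cong x≈a) ⟩
        0# - 0#                 ≈⟨ -‿inverseʳ 0# ⟩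
        0#                      ∎)

  record Eigenfamily {m n} (M : Matrix n) (ev : Vector Carrier m) : Set where
    field
      vec        : Fin m → Vector Carrier n
      nonzero    : ∀ i → Nonzero (vec i)
      eigen      : ∀ i → Eigenvector M (ev i) (vec i)
      orthogonal : ∀ i j → i ≢ j → vec i · vec j ≈ 0#

  module _ {m n} {M : Matrix n} (M-sym : IsSymmetric M) (ev : Vector Carrier (suc m)) {v : Vector Carrier n}
           (v≉0 : Nonzero v) (Mv : Eigenvector M (ev zero) v) {τ : Carrier} (ev≉τ : ∀ i → ¬ (ev i ≈ τ)) where
    open Deflation M-sym v≉0 Mv τ

    prepend : Eigenfamily deflated (ev ∘ suc) → Eigenfamily M ev
    prepend F = record
      { vec        = vec′
      ; nonzero    = λ { zero → v≉0 ; (suc i) → nonzero i }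
      ; eigen      = λ { zero → Mv ; (suc i) → undeflate (ev≉τ (suc i)) (eigen i) }
      ; orthogonal = orth
      }
      where
      open Eigenfamily F
      vec′ : Fin (suc m) → Vector Carrier n
      vec′ = v ∷ vec
      orth : ∀ i j → i ≢ j → vec′ i · vec′ j ≈ 0#
      orth zero    zero    i≢j = contradiction ≡.refl i≢j
      orth zero    (suc j) _   = orthogonal-to-v (ev≉τ (suc j)) (eigen j)
      orth (suc i) zero    _   = trans (·-comm (vec i) v) (orthogonal-to-v (ev≉τ (suc i)) (eigen i))
      orth (suc i) (suc j) i≢j = orthogonal i j (i≢j ∘ ≡.cong suc)

  eigenvector-of-root : ∀ {n} (M : Matrix n) {a} → charPoly M a ≈ 0# → ∃[ v ] Nonzero v × Eigenvector M a v
  eigenvector-of-root M {a} root with v , v≉0 , Av≈0 ← det≈0⇒kernel (charMatrix M a) root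
    = v , v≉0 , λ i → sym (x-y≈0⇒x≈y (trans (sym (charMatrix-⊗ᵥ M a v i)) (Av≈0 i)))

  roots : ∀ {m} → Vector Carrier m → Carrier → Carrier
  roots ev x = product λ i → x - ev i

  lipschitz-roots : ∀ {m} (ev : Vector Carrier m) → Lipschitz (roots ev)
  lipschitz-roots ev = lipschitz-product λ i → lipschitz-sub lipschitz-id (lipschitz-const (ev i))

  -- The roots in `ev` are still to be treated, and `q` collects the other factors: each deflation
  -- turns x - ev zero into x - τ and hands it to `q`. As τ avoids all of `ev`, the later
  -- eigenvectors can be carried back through every shift.
  eigenfamily : ∀ {m n} (M : Matrix n) → IsSymmetric M → (ev : Vector Carrier m) → ∀ τ → (∀ i → ¬ (ev i ≈ τ)) →
                ∀ q → Lipschitz q → (∀ x → charPoly M x ≈ q x * roots ev x) → Eigenfamily M ev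

  -- The same recursion with the first eigenvector prescribed, so that the walk can start its basis
  -- at the constant vector.
  eigenfamily-extending : ∀ {m n} (M : Matrix n) → IsSymmetric M → (ev : Vector Carrier (suc m)) →
                          ∀ τ → (∀ i → ¬ (ev i ≈ τ)) → ∀ q → Lipschitz q → (∀ x → charPoly M x ≈ q x * roots ev x) →
                          ∀ v → Nonzero v → Eigenvector M (ev zero) v →
                          ∃[ F ] ∀ j → Eigenfamily.vec {M = M} {ev} F zero j ≡ v j

  eigenfamily {zero}  M M-sym ev τ ev≉τ q Lq M≈ = record { vec = λ () ; nonzero = λ () ; eigen = λ () ; orthogonal = λ () }
  eigenfamily {suc m} M M-sym ev τ ev≉τ q Lq M≈ =
    let v , v≉0 , Mv = eigenvector-of-root M root in
    proj₁ (eigenfamily-extending M M-sym ev τ ev≉τ q Lq M≈ v v≉0 Mv)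
    where
    root : charPoly M (ev zero) ≈ 0#
    root = begin
      charPoly M (ev zero)
        ≈⟨ M≈ (ev zero) ⟩
      q (ev zero) * ((ev zero - ev zero) * roots (ev ∘ suc) (ev zero))
        ≈⟨ solve 3 (λ q e r → q :* ((e :- e) :* r) := 0:) refl (q (ev zero)) (ev zero) (roots (ev ∘ suc) (ev zero)) ⟩
      0# ∎

  eigenfamily-extending M M-sym ev τ ev≉τ q Lq M≈ v v≉0 Mv =
    prepend M-sym ev v≉0 Mv ev≉τ (eigenfamily deflated deflated-symmetric (ev ∘ suc) τ (ev≉τ ∘ suc)
      (λ x → (x - τ) * q x) (lipschitz-* {λ x → x - τ} {q} (lipschitz-sub lipschitz-id (lipschitz-const τ)) Lq)
      (charPoly-deflated {q} {roots (ev ∘ suc)} Lq (lipschitz-roots (ev ∘ suc)) M≈)) ,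
    λ j → ≡.refl
    where open Deflation M-sym v≉0 Mv τ

  -- Orthogonal families and Parseval's identity

  ·-combination : ∀ {m n} (y : Vector Carrier n) (c : Vector Carrier m) (v : Fin m → Vector Carrier n) →
                  y · (λ i → sum λ k → c k * v k i) ≈ sum (λ k → c k * y · v k)
  ·-combination y c v = begin
    sum (λ i → y i * sum (λ k → c k * v k i))
      ≈⟨ sum-cong (λ i → *-distribˡ-sum (y i) (λ k → c k * v k i)) ⟩
    sum (λ i → sum (λ k → y i * (c k * v k i)))      ≈⟨ ∑-comm (λ i k → y i * (c k * v k i)) ⟩
    sum (λ k → sum (λ i → y i * (c k * v k i)))
      ≈⟨ sum-cong (λ k → sum-cong λ i → solve 3 (λ y c v → y :* (c :* v) := c :* (y :* v)) refl (y i) (c k) (v k i)) ⟩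
    sum (λ k → sum (λ i → c k * (y i * v k i)))
      ≈⟨ sum-cong (λ k → *-distribˡ-sum (c k) (λ i → y i * v k i)) ⟨
    sum (λ k → c k * y · v k)                        ∎

  IsOrthogonal : ∀ {m n} → (Fin m → Vector Carrier n) → Set
  IsOrthogonal v = ∀ i j → i ≢ j → v i · v j ≈ 0#

  ·-orthogonal-combination : ∀ {m n} {v : Fin m → Vector Carrier n} → IsOrthogonal v → ∀ c l →
                             v l · (λ i → sum λ k → c k * v k i) ≈ c l * v l · v l
  ·-orthogonal-combination {v = v} orth c l = trans (·-combination (v l) c v)
    (sum-single (λ k → c k * v l · v k) l λ k k≢l → trans (*-congˡ (orth l k (k≢l ∘ ≡.sym))) (zeroʳ (c k)))

  ·-zeroʳ : ∀ {n} (x : Vector Carrier n) {y} → (∀ i → y i ≈ 0#) → x · y ≈ 0#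
  ·-zeroʳ x y≈0 = sum-zero λ i → trans (*-congˡ (y≈0 i)) (zeroʳ (x i))

  module OrthogonalBasis {n} {v : Fin n → Vector Carrier n} (v≉0 : ∀ i → Nonzero (v i)) (orth : IsOrthogonal v) where

    -- A nonzero `g` would extend `v` to n + 1 orthogonal nonzero vectors in dimension n. These
    -- satisfy a nontrivial linear relation, whose dot product with a vector of nonzero coefficient
    -- is a contradiction.
    orthogonal⇒zero : ∀ g → (∀ i → g · v i ≈ 0#) → ∀ j → g j ≈ 0#
    orthogonal⇒zero g g⊥v with pivot? g
    ... | inj₂ g≈0 = g≈0
    ... | inj₁ g≉0 =
      let x , (l , xl≉0) , Ux≈0 = underdetermined ℕ.≤-refl (λ i k → u k i) in
      contradiction (begin
        u l · u l * x l                          ≈⟨ *-comm _ _ ⟩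
        x l * u l · u l                          ≈⟨ ·-orthogonal-combination {v = u} u-orth x l ⟨
        u l · (λ i → sum λ k → x k * u k i)
          ≈⟨ ·-zeroʳ (u l) (λ i → trans (sum-cong λ k → *-comm (x k) (u k i)) (Ux≈0 i)) ⟩
        0#                                       ∎)
        (xl≉0 ∘ *≈0⇒≈0 (nonzero⇒x·x≉0 (u l) (u≉0 l)))
      where
      u : Fin (suc n) → Vector Carrier n
      u = g ∷ v
      u≉0 : ∀ l → Nonzero (u l)
      u≉0 zero    = g≉0
      u≉0 (suc i) = v≉0 i
      u-orth : IsOrthogonal u
      u-orth zero    zero    i≢j = contradiction ≡.refl i≢j
      u-orth zero    (suc j) _   = g⊥v j
      u-orth (suc i) zero    _   = trans (·-comm (v i) g) (g⊥v i)
      u-orth (suc i) (suc j) i≢j = orth i j (i≢j ∘ ≡.cong suc)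

    -- Inverse squared norms: the correction that replaces normalising the `v i`.
    weight : Vector Carrier n
    weight i = (v i · v i) ⁻¹

    weight-nonneg : ∀ i → 0# ≤ weight i
    weight-nonneg i = ⁻¹-nonneg (x·x-nonneg (v i)) (nonzero⇒x·x≉0 (v i) (v≉0 i))

    -- The difference of the two sides is orthogonal to every `v i`, hence zero.
    expansion : ∀ g j → g j ≈ sum (λ k → weight k * g · v k * v k j)
    expansion g j = x-y≈0⇒x≈y (orthogonal⇒zero (λ j → g j - p j) (λ i → begin
      (λ j → g j - p j) · v i
        ≈⟨ sum-cong (λ j → solve 3 (λ g p v → (g :- p) :* v := g :* v :- v :* p) refl (g j) (p j) (v i j)) ⟩
      sum (λ j → g j * v i j - v i j * p j)  ≈⟨ sum-sub (λ j → g j * v i j) (λ j → v i j * p j) ⟩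
      g · v i - v i · p
        ≈⟨ +-congˡ (-‿cong (·-orthogonal-combination {v = v} orth c i)) ⟩
      g · v i - c i * v i · v i
        ≈⟨ solve 3 (λ w d n → d :- w :* d :* n := d :- w :* n :* d) refl (weight i) (g · v i) (v i · v i) ⟩
      g · v i - weight i * v i · v i * g · v i
        ≈⟨ +-congˡ (-‿cong (trans (*-congʳ (⁻¹-inverseˡ (nonzero⇒x·x≉0 (v i) (v≉0 i)))) (*-identityˡ _))) ⟩
      g · v i - g · v i                      ≈⟨ -‿inverseʳ _ ⟩
      0#                                     ∎) j)
      where
      c p : Vector Carrier n
      c k = weight k * g · v k
      p j = sum λ k → c k * v k j

    parseval : ∀ g → g · g ≈ sum (λ k → weight k * (g · v k * g · v k))
    parseval g = begin
      g · g
        ≈⟨ ·-cong (λ i → refl {g i}) (expansion g) ⟩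
      g · (λ j → sum (λ k → weight k * g · v k * v k j))
        ≈⟨ ·-combination g (λ k → weight k * g · v k) v ⟩
      sum (λ k → weight k * g · v k * g · v k)
        ≈⟨ sum-cong (λ k → *-assoc (weight k) (g · v k) (g · v k)) ⟩
      sum (λ k → weight k * (g · v k * g · v k))                  ∎

    -- `M` multiplies the coefficient of `g` at `v k` by `ev k`, so the Parseval sums compare term
    -- by term: a term either is zero or grows by a factor at most `L`.
    ⊗ᵥ-contraction : ∀ {M : Matrix n} → IsSymmetric M → ∀ {ev : Vector Carrier n} → (∀ i → Eigenvector M (ev i) (v i)) → ∀ L g →
                     (∀ i → g · v i ≈ 0# ⊎ ev i * ev i ≤ L) → (M ⊗ᵥ g) · (M ⊗ᵥ g) ≤ L * g · g
    ⊗ᵥ-contraction {M} M-sym {ev} Mv L g bound = ≤-respˡ-≈ (sym (parseval (M ⊗ᵥ g)))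
      (≤-respʳ-≈ (sym (trans (*-congˡ (parseval g)) (*-distribˡ-sum L (λ k → weight k * (g · v k * g · v k)))))
        (sum-mono-≤ λ k → ≤-respˡ-≈ (*-congˡ (sym (*-cong (coefficient k) (coefficient k)))) (term k (bound k))))
      where
      coefficient : ∀ k → (M ⊗ᵥ g) · v k ≈ ev k * g · v k
      coefficient k = begin
        (M ⊗ᵥ g) · v k                 ≈⟨ ⊗ᵥ-·-adjoint M-sym g (v k) ⟩
        g · (M ⊗ᵥ v k)                 ≈⟨ ·-cong (λ i → refl {g i}) (Mv k) ⟩
        g · (λ i → ev k * v k i)       ≈⟨ ·-comm g _ ⟩
        (λ i → ev k * v k i) · g       ≈⟨ ·-scaleˡ (ev k) (v k) g ⟩
        ev k * v k · g                 ≈⟨ *-congˡ (·-comm (v k) g) ⟩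
        ev k * g · v k                 ∎
      term : ∀ k → g · v k ≈ 0# ⊎ ev k * ev k ≤ L →
             weight k * ((ev k * g · v k) * (ev k * g · v k)) ≤ L * (weight k * (g · v k * g · v k))
      term k (inj₁ d≈0) = ≤-reflexive (begin
        weight k * ((ev k * g · v k) * (ev k * g · v k))   ≈⟨ *-congˡ (*-cong (*-congˡ d≈0) (*-congˡ d≈0)) ⟩
        weight k * ((ev k * 0#) * (ev k * 0#))
          ≈⟨ solve 3 (λ w e l → w :* (e :* 0: :* (e :* 0:)) := l :* (w :* (0: :* 0:))) refl (weight k) (ev k) L ⟩
        L * (weight k * (0# * 0#))                         ≈⟨ *-congˡ (*-congˡ (*-cong d≈0 d≈0)) ⟨
        L * (weight k * (g · v k * g · v k))               ∎)
      term k (inj₂ ev²≤L) = ≤-respˡ-≈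
        (solve 3 (λ w e d → e :* e :* (w :* (d :* d)) := w :* (e :* d :* (e :* d))) refl (weight k) (ev k) (g · v k))
        (*-monoʳ-≤ (*-nonneg (weight-nonneg k) (x²-nonneg (g · v k))) ev²≤L)

  -- Sparse nonnegative solutions

  card-removeAt : ∀ {n} (f : Vector Bool (suc n)) p → f p ≡ false →
                  card (Vec.tabulate f) ≡ card (Vec.tabulate (removeAt f p))
  card-removeAt f zero eq rewrite eq = ≡.refl
  card-removeAt {suc n} f (suc p) eq with f zero
  ... | true  = ≡.cong suc (card-removeAt (f ∘ suc) p eq)
  ... | false = card-removeAt (f ∘ suc) p eq

  card-cong : ∀ {n} {f g : Vector Bool n} → (∀ i → f i ≡ g i) → card (Vec.tabulate f) ≡ card (Vec.tabulate g)
  card-cong f≡g = ≡.cong card (Vec.tabulate-cong f≡g)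

  -- A kernel vector may be replaced by its negative, so one with a positive entry is always
  -- available for `least-ratio`.
  positive-entry : ∀ {n} (x : Vector Carrier n) → Nonzero x → (∃[ j ] ¬ (x j ≤ 0#)) ⊎ (∃[ j ] ¬ (- x j ≤ 0#))
  positive-entry x (j , xj≉0) with x j ≤? 0#
  ... | no  xj≰0 = inj₁ (j , xj≰0)
  ... | yes xj≤0 = inj₂ (j , λ -xj≤0 → xj≉0 (antisym xj≤0
    (≤-respʳ-≈ (solve 1 (λ x → :- :- x := x) refl (x j)) (neg-nonneg -xj≤0))))

  -- μ p / x p is the least ratio over the positive entries of x, stated without division.
  least-ratio : ∀ {n} (μ x : Vector Carrier n) → (∃[ j ] ¬ (x j ≤ 0#)) →
                ∃[ p ] ¬ (x p ≤ 0#) × (∀ j → ¬ (x j ≤ 0#) → μ p * x j ≤ μ j * x p)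
  least-ratio {suc n} μ x (j , xj≰0) with Fin.any? (λ i → ¬? (x (suc i) ≤? 0#))
  ... | no tail≤0 = zero , head-positive j xj≰0 , least
    where
    head-positive : ∀ j → ¬ (x j ≤ 0#) → ¬ (x zero ≤ 0#)
    head-positive zero    x₀≰0 = x₀≰0
    head-positive (suc j) xj≰0 = contradiction (j , xj≰0) tail≤0
    least : ∀ j → ¬ (x j ≤ 0#) → μ zero * x j ≤ μ j * x zero
    least zero    _    = ≤-refl
    least (suc j) xj≰0 = contradiction (j , xj≰0) tail≤0
  ... | yes tail≰0 with least-ratio (μ ∘ suc) (x ∘ suc) tail≰0
  ...   | p , xp≰0 , p-least with x zero ≤? 0#
  ...     | yes x₀≤0 = suc p , xp≰0 , λ { zero x₀≰0 → contradiction x₀≤0 x₀≰0 ; (suc j) xj≰0 → p-least j xj≰0 }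
  ...     | no  x₀≰0 with total (μ (suc p) * x zero) (μ zero * x (suc p))
  ...       | inj₁ p≤0 = suc p , xp≰0 , λ { zero _ → p≤0 ; (suc j) xj≰0 → p-least j xj≰0 }
  ...       | inj₂ 0≤p = zero , x₀≰0 , λ { zero _ → ≤-refl ; (suc j) xj≰0 → compare j (p-least j xj≰0) xj≰0 }
    where
    pos : ∀ {y} → ¬ (y ≤ 0#) → 0# ≤ y
    pos {y} y≰0 = [ id , (λ y≤0 → contradiction y≤0 y≰0) ]′ (total 0# y)
    compare : ∀ j → μ (suc p) * x (suc j) ≤ μ (suc j) * x (suc p) → ¬ (x (suc j) ≤ 0#) → μ zero * x (suc j) ≤ μ (suc j) * x zero
    -- Transitivity of ratios in cross-multiplied form: both comparisons are scaled to meet, and the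
    -- positive entry at `p` is cancelled.
    compare j p≤j xj≰0 = *-cancelˡ-≤ (pos xp≰0) (xp≰0 ∘ ≤-reflexive)
      (≤-respˡ-≈ (solve 3 (λ m p j → j :* (m :* p) := p :* (m :* j)) refl (μ zero) (x (suc p)) (x (suc j)))
        (≤-respʳ-≈ (solve 3 (λ m p z → z :* (m :* p) := p :* (m :* z)) refl (μ (suc j)) (x (suc p)) (x zero))
          (≤-trans (*-monoˡ-≤ (pos xj≰0) 0≤p)
            (≤-respˡ-≈ (solve 3 (λ m j z → z :* (m :* j) := j :* (m :* z)) refl (μ (suc p)) (x (suc j)) (x zero))
              (*-monoˡ-≤ (pos x₀≰0) p≤j)))))

  module _ {ℓ n} (A : Fin ℓ → Vector Carrier n) {μ : Vector Carrier n} (0≤μ : ∀ j → 0# ≤ μ j) where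

    -- Moves from `μ` in the direction -x until the first entry reaches zero. This happens at the
    -- least ratio t = μ p / x p; entries with x j ≤ 0 never decrease, and the products with `A`
    -- stay fixed because x lies in the kernel.
    cancel-entry-along : ∀ x → (∃[ j ] ¬ (x j ≤ 0#)) → (∀ i → A i · x ≈ 0#) →
                         ∃[ p ] ∃[ ν ] (∀ j → 0# ≤ ν j) × ν p ≈ 0# × (∀ i → A i · ν ≈ A i · μ)
    cancel-entry-along x x≰0 Ax≈0 =
      let p , xp≰0 , p-least = least-ratio μ x x≰0 in p , step p xp≰0 p-least
      where
      step : ∀ p → ¬ (x p ≤ 0#) → (∀ j → ¬ (x j ≤ 0#) → μ p * x j ≤ μ j * x p) →
             ∃[ ν ] (∀ j → 0# ≤ ν j) × ν p ≈ 0# × (∀ i → A i · ν ≈ A i · μ)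
      step p xp≰0 p-least = ν , ν-nonneg , νp≈0 , Aν≈Aμ
        where
        xp≉0 : ¬ (x p ≈ 0#)
        xp≉0 = xp≰0 ∘ ≤-reflexive
        0≤xp : 0# ≤ x p
        0≤xp = [ id , (λ xp≤0 → contradiction xp≤0 xp≰0) ]′ (total 0# (x p))
        t : Carrier
        t = μ p * x p ⁻¹
        0≤t : 0# ≤ t
        0≤t = *-nonneg (0≤μ p) (⁻¹-nonneg 0≤xp xp≉0)
        xp*t≈μp : x p * t ≈ μ p
        xp*t≈μp = begin
          x p * (μ p * x p ⁻¹)
            ≈⟨ solve 3 (λ x m i → x :* (m :* i) := x :* i :* m) refl (x p) (μ p) (x p ⁻¹) ⟩
          x p * x p ⁻¹ * μ p        ≈⟨ *-congʳ (⁻¹-inverseʳ xp≉0) ⟩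
          1# * μ p                  ≈⟨ *-identityˡ _ ⟩
          μ p                       ∎
        ν : Vector Carrier n
        ν j = μ j + - t * x j
        νp≈0 : ν p ≈ 0#
        νp≈0 = trans (+-congˡ (trans (solve 2 (λ t x → :- t :* x := :- (x :* t)) refl t (x p)) (-‿cong xp*t≈μp))) (-‿inverseʳ (μ p))
        ν-nonneg : ∀ j → 0# ≤ ν j
        ν-nonneg j with x j ≤? 0#
        ... | yes xj≤0 = +-nonneg (0≤μ j) (≤-respʳ-≈ (solve 2 (λ t x → t :* :- x := :- t :* x) refl t (x j)) (*-nonneg 0≤t (neg-nonneg xj≤0)))
        ... | no  xj≰0 = *-cancelˡ-≤ 0≤xp xp≉0 (≤-respˡ-≈ (sym (zeroʳ (x p)))
                           (≤-respʳ-≈ (begin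
                             μ j * x p - μ p * x j            ≈⟨ +-congˡ (-‿cong (*-congʳ xp*t≈μp)) ⟨
                             μ j * x p - x p * t * x j
                               ≈⟨ solve 4 (λ m p t x → m :* p :- p :* t :* x := p :* (m :+ :- t :* x)) refl (μ j) (x p) t (x j) ⟩
                             x p * ν j                        ∎) (x≤y⇒0≤y-x (p-least j xj≰0))))
        Aν≈Aμ : ∀ i → A i · ν ≈ A i · μ
        Aν≈Aμ i = begin
          A i · ν                     ≈⟨ ·-distribˡ-+* (A i) μ x (- t) ⟩
          A i · μ + - t * A i · x     ≈⟨ +-congˡ (trans (*-congˡ (Ax≈0 i)) (zeroʳ (- t))) ⟩
          A i · μ + 0#                ≈⟨ +-identityʳ _ ⟩
          A i · μ                     ∎

    cancel-entry : ∀ x → Nonzero x → (∀ i → A i · x ≈ 0#) →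
                   ∃[ p ] ∃[ ν ] (∀ j → 0# ≤ ν j) × ν p ≈ 0# × (∀ i → A i · ν ≈ A i · μ)
    cancel-entry x x≉0 Ax≈0 with positive-entry x x≉0
    ... | inj₁ x≰0  = cancel-entry-along x x≰0 Ax≈0
    ... | inj₂ -x≰0 = cancel-entry-along (λ j → - x j) -x≰0 λ i → begin
      A i · (λ j → - x j)
        ≈⟨ sum-cong (λ j → solve 2 (λ a x → a :* :- x := a :* 0: :+ :- 1: :* (a :* x)) refl (A i j) (x j)) ⟩
      sum (λ j → A i j * 0# + - 1# * (A i j * x j))
        ≈⟨ ∑-distrib-+ (λ j → A i j * 0#) (λ j → - 1# * (A i j * x j)) ⟩
      A i · (λ _ → 0#) + sum (λ j → - 1# * (A i j * x j))
        ≈⟨ +-cong (sum-zero λ j → zeroʳ (A i j)) (sym (*-distribˡ-sum (- 1#) (λ j → A i j * x j))) ⟩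
      0# + - 1# * A i · x                  ≈⟨ +-congˡ (*-congˡ (Ax≈0 i)) ⟩
      0# + - 1# * 0#                       ≈⟨ solve 0 (0: :+ :- 1: :* 0: := 0:) refl ⟩
      0#                                   ∎

  ·-insertAt-0 : ∀ {n} (a : Vector Carrier (suc n)) (ν : Vector Carrier n) p → a · insertAt ν p 0# ≈ removeAt a p · ν
  ·-insertAt-0 a ν p = begin
    a · insertAt ν p 0#
      ≈⟨ sum-remove {i = p} (λ j → a j * insertAt ν p 0# j) ⟩
    a p * insertAt ν p 0# p + sum (λ k → a (punchIn p k) * insertAt ν p 0# (punchIn p k))
      ≈⟨ +-cong (trans (*-congˡ (reflexive (insertAt-lookup ν p 0#))) (zeroʳ (a p)))
                (sum-cong λ k → *-congˡ {x = a (punchIn p k)} (reflexive (insertAt-punchIn ν p 0# k))) ⟩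
    0# + removeAt a p · ν
      ≈⟨ +-identityˡ _ ⟩
    removeAt a p · ν ∎

  card-support-insertAt-0 : ∀ {n} (ν : Vector Carrier n) p → card (support (insertAt ν p 0#)) ≡ card (support ν)
  card-support-insertAt-0 ν p = ≡.trans
    (card-removeAt (nonzero? ∘ insertAt ν p 0#) p (≡.trans (≡.cong nonzero? (insertAt-lookup ν p 0#)) zero-false))
    (card-cong λ k → ≡.cong nonzero? (insertAt-punchIn ν p 0# k))
    where
    nonzero? : Carrier → Bool
    nonzero? x = not (does (x ≟ 0#))
    zero-false : nonzero? 0# ≡ false
    zero-false with 0# ≟ 0#
    ... | yes _   = ≡.refl
    ... | no 0≉0  = contradiction refl 0≉0

  insertAt-0-nonneg : ∀ {n} {ν : Vector Carrier n} → (∀ j → 0# ≤ ν j) → ∀ p j → 0# ≤ insertAt ν p 0# j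
  insertAt-0-nonneg 0≤ν zero    zero    = ≤-refl
  insertAt-0-nonneg 0≤ν zero    (suc j) = 0≤ν j
  insertAt-0-nonneg {suc n} 0≤ν (suc p) zero    = 0≤ν zero
  insertAt-0-nonneg {suc n} 0≤ν (suc p) (suc j) = insertAt-0-nonneg (0≤ν ∘ suc) p j

  -- While there are more coordinates than conditions, the kernel is nontrivial and an entry can be
  -- cancelled; its coordinate is deleted for the recursion and put back as 0. This is the conic
  -- version, with bound ℓ: total mass is not preserved unless the rows of `A` say so.
  carathéodory : ∀ {ℓ} n (A : Fin ℓ → Vector Carrier n) {μ : Vector Carrier n} → (∀ j → 0# ≤ μ j) →
                 ∃[ ν ] (∀ j → 0# ≤ ν j) × (∀ i → A i · ν ≈ A i · μ) × card (support ν) ℕ.≤ ℓ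
  carathéodory {ℓ} n A {μ} 0≤μ with n ℕ.≤? ℓ
  ... | yes n≤ℓ = μ , 0≤μ , (λ i → refl) , ℕ.≤-trans (Subset.∣p∣≤n (support μ)) n≤ℓ
  carathéodory {ℓ} zero A {μ} 0≤μ | no 0≰ℓ = contradiction ℕ.z≤n 0≰ℓ
  carathéodory {ℓ} (suc n) A {μ} 0≤μ | no n≰ℓ =
    let x , x≉0 , Ax≈0 = underdetermined (ℕ.s≤s⁻¹ (ℕ.≰⇒> n≰ℓ)) A
        p , ξ , 0≤ξ , ξp≈0 , Aξ≈Aμ = cancel-entry A 0≤μ x x≉0 Ax≈0
        ν , 0≤ν , Aν≈Aξ , card≤ℓ = carathéodory n (λ i → removeAt (A i) p) {removeAt ξ p} (λ j → 0≤ξ (punchIn p j))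
    in insertAt ν p 0# , insertAt-0-nonneg 0≤ν p ,
       (λ i → begin
         A i · insertAt ν p 0#                       ≈⟨ ·-insertAt-0 (A i) ν p ⟩
         removeAt (A i) p · ν                        ≈⟨ Aν≈Aξ i ⟩
         removeAt (A i) p · removeAt ξ p             ≈⟨ +-identityˡ _ ⟨
         0# + removeAt (A i) p · removeAt ξ p        ≈⟨ +-congʳ (trans (*-congˡ ξp≈0) (zeroʳ (A i p))) ⟨
         A i p * ξ p + removeAt (A i) p · removeAt ξ p ≈⟨ sum-remove {i = p} (λ j → A i j * ξ j) ⟨
         A i · ξ                                     ≈⟨ Aξ≈Aμ i ⟩
         A i · μ                                     ∎) ,
       ℕ.≤-trans (ℕ.≤-reflexive (card-support-insertAt-0 ν p)) card≤ℓ

  -- The random walk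

  ∣x∣^2≈x*x : ∀ x → ∣ x ∣ ^ 2 ≈ x * x
  ∣x∣^2≈x*x x with 0# ≤? x
  ... | yes _ = *-congˡ (*-identityʳ x)
  ... | no _  = solve 1 (λ x → :- x :* (:- x :* 1:) := x :* x) refl x

  0≤∣x∣ : ∀ x → 0# ≤ ∣ x ∣
  0≤∣x∣ x with 0# ≤? x | total 0# x
  ... | yes 0≤x | _        = 0≤x
  ... | no  0≰x | inj₁ 0≤x = contradiction 0≤x 0≰x
  ... | no  _   | inj₂ x≤0 = neg-nonneg x≤0

  ∣x∣≤∣y∣⇒x²≤y² : ∀ {x y} → ∣ x ∣ ≤ ∣ y ∣ → x * x ≤ y * y
  ∣x∣≤∣y∣⇒x²≤y² {x} {y} ∣x∣≤∣y∣ = ≤-respˡ-≈ (square x) (≤-respʳ-≈ (square y)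
    (≤-trans (*-monoˡ-≤ (0≤∣x∣ x) ∣x∣≤∣y∣) (*-monoʳ-≤ (0≤∣x∣ y) ∣x∣≤∣y∣)))
    where
    square : ∀ x → ∣ x ∣ * ∣ x ∣ ≈ x * x
    square x = trans (*-congˡ (sym (*-identityʳ ∣ x ∣))) (∣x∣^2≈x*x x)

  fromℕ-nonneg : ∀ m → 0# ≤ fromℕ m
  fromℕ-nonneg zero    = ≤-refl
  fromℕ-nonneg (suc m) = +-nonneg 0≤1 (fromℕ-nonneg m)

  fromℕ≉0 : ∀ {m} → m ≢ 0 → ¬ (fromℕ m ≈ 0#)
  fromℕ≉0 {zero}  m≢0 _  = m≢0 ≡.refl
  fromℕ≉0 {suc m} _   eq = 1≰0 (≤-respʳ-≈ eq (≤-respˡ-≈ (+-identityʳ 1#) (+-mono-≤ ≤-refl (fromℕ-nonneg m))))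

  sum-const : ∀ n c → sum {n} (λ _ → c) ≈ fromℕ n * c
  sum-const zero    c = sym (zeroˡ c)
  sum-const (suc n) c = trans (+-congˡ (sum-const n c)) (solve 2 (λ c m → c :+ m :* c := (1: :+ m) :* c) refl c (fromℕ n))

  sum-indicator : ∀ {n} (f : Vector Bool n) → sum (λ i → if f i then 1# else 0#) ≈ fromℕ (card (Vec.tabulate f))
  sum-indicator {zero}  f = refl
  sum-indicator {suc n} f with f zero
  ... | true  = +-congˡ (sum-indicator (f ∘ suc))
  ... | false = trans (+-identityˡ _) (sum-indicator (f ∘ suc))

  card≢0 : ∀ {n} (f : Vector Bool n) j → T (f j) → card (Vec.tabulate f) ≢ 0
  card≢0 f zero fj with f zero
  ... | true = λ ()
  card≢0 f (suc j) fj with f zero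
  ... | true  = λ ()
  ... | false = card≢0 (f ∘ suc) j fj

  -- Total mass 1 turns the left side into μ · μ - 1/n, and μ · μ is at most the mass because every
  -- entry is at most 1.
  distance²≤1 : ∀ {n} → n ≢ 0 → ∀ {μ : Vector Carrier n} → IsProbability μ →
                (λ v → μ v - fromℕ n ⁻¹) · (λ v → μ v - fromℕ n ⁻¹) ≤ 1#
  distance²≤1 {n} n≢0 {μ} (0≤μ , sum≈1) = ≤-trans (≤-respˡ-≈ (sym expand) drop) μ·μ≤1
    where
    u : Carrier
    u = fromℕ n ⁻¹
    0≤u : 0# ≤ u
    0≤u = ⁻¹-nonneg (fromℕ-nonneg n) (fromℕ≉0 n≢0)
    drop : μ · μ - u ≤ μ · μ
    drop = ≤-by 0≤u (solve 2 (λ m u → m :- (m :- u) := u) refl (μ · μ) u)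
    μ≤1 : ∀ v → μ v ≤ 1#
    μ≤1 v = ≤-respʳ-≈ sum≈1 (term≤sum 0≤μ v)
    μ·μ≤1 : μ · μ ≤ 1#
    μ·μ≤1 = ≤-respʳ-≈ sum≈1 (sum-mono-≤ λ v → ≤-respʳ-≈ (*-identityʳ (μ v)) (*-monoˡ-≤ (0≤μ v) (μ≤1 v)))
    expand : (λ v → μ v - u) · (λ v → μ v - u) ≈ μ · μ - u
    expand = begin
      sum (λ v → (μ v - u) * (μ v - u))
        ≈⟨ sum-cong (λ v → solve 2 (λ m u → (m :- u) :* (m :- u) := m :* m :+ u :* u :- (m :+ m) :* u) refl (μ v) u) ⟩
      sum (λ v → μ v * μ v + u * u - (μ v + μ v) * u)
        ≈⟨ sum-sub (λ v → μ v * μ v + u * u) (λ v → (μ v + μ v) * u) ⟩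
      sum (λ v → μ v * μ v + u * u) - sum (λ v → (μ v + μ v) * u)
        ≈⟨ +-cong (trans (∑-distrib-+ (λ v → μ v * μ v) (λ v → u * u)) (+-congˡ (sum-const n (u * u))))
                  (-‿cong (trans (sym (*-distribʳ-sum u (λ v → μ v + μ v))) (*-congʳ (trans (∑-distrib-+ μ μ) (+-cong sum≈1 sum≈1))))) ⟩
      μ · μ + fromℕ n * (u * u) - (1# + 1#) * u
        ≈⟨ +-congʳ (+-congˡ (trans (sym (*-assoc _ _ _)) (*-congʳ (⁻¹-inverseʳ (fromℕ≉0 n≢0))))) ⟩
      μ · μ + 1# * u - (1# + 1#) * u
        ≈⟨ solve 2 (λ m u → m :+ 1: :* u :- (1: :+ 1:) :* u := m :- u) refl (μ · μ) u ⟩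
      μ · μ - u ∎

  module _ {n d} (G : Graph n) (regular : Graph.Regular G d) where
    open Graph G

    AD⁻¹-entry : ∀ u v → AD⁻¹ G u v ≈ adjacency G u v * fromℕ d ⁻¹
    AD⁻¹-entry u v = begin
      sum (λ k → adjacency G u k * diagonal δ k v)
        ≈⟨ sum-single (λ k → adjacency G u k * diagonal δ k v) v
             (λ k k≢v → trans (*-congˡ (diagonal-off δ k≢v)) (zeroʳ (adjacency G u k))) ⟩
      adjacency G u v * diagonal δ v v
        ≈⟨ *-congˡ (trans (diagonal-at δ v) (reflexive (≡.cong (λ d → fromℕ d ⁻¹) (regular v)))) ⟩
      adjacency G u v * fromℕ d ⁻¹ ∎
      where
      δ : Vector Carrier n
      δ v = fromℕ (degree v) ⁻¹

    adj-symmetric : ∀ u v → adj u v ≡ adj v u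
    adj-symmetric u v with adj u v | adj v u | symmetric {u} {v} | symmetric {v} {u}
    ... | true  | true  | _ | _ = ≡.refl
    ... | false | false | _ | _ = ≡.refl
    ... | true  | false | f | _ = contradiction (f _) id
    ... | false | true  | _ | f = contradiction (f _) id

    AD⁻¹-symmetric : IsSymmetric (AD⁻¹ G)
    AD⁻¹-symmetric u v = begin
      AD⁻¹ G u v                          ≈⟨ AD⁻¹-entry u v ⟩
      adjacency G u v * fromℕ d ⁻¹
        ≡⟨ ≡.cong (λ b → (if b then 1# else 0#) * fromℕ d ⁻¹) (adj-symmetric u v) ⟩
      adjacency G v u * fromℕ d ⁻¹        ≈⟨ AD⁻¹-entry v u ⟨
      AD⁻¹ G v u                          ∎

    -- The matrix is normalised by columns; by regularity its rows sum to 1 as well.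
    AD⁻¹-const : d ≢ 0 → ∀ c u → (AD⁻¹ G ⊗ᵥ (λ _ → c)) u ≈ c
    AD⁻¹-const d≢0 c u = begin
      sum (λ v → AD⁻¹ G u v * c)                      ≈⟨ sum-cong (λ v → *-congʳ (AD⁻¹-entry u v)) ⟩
      sum (λ v → adjacency G u v * fromℕ d ⁻¹ * c)
        ≈⟨ sum-cong (λ v → *-assoc (adjacency G u v) (fromℕ d ⁻¹) c) ⟩
      sum (λ v → adjacency G u v * (fromℕ d ⁻¹ * c))  ≈⟨ *-distribʳ-sum (fromℕ d ⁻¹ * c) (adjacency G u) ⟨
      sum (adjacency G u) * (fromℕ d ⁻¹ * c)
        ≈⟨ *-congʳ (trans (sum-indicator (adj u)) (reflexive (≡.cong fromℕ (regular u)))) ⟩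
      fromℕ d * (fromℕ d ⁻¹ * c)                      ≈⟨ *-assoc _ _ _ ⟨
      fromℕ d * fromℕ d ⁻¹ * c                        ≈⟨ *-congʳ (⁻¹-inverseʳ (fromℕ≉0 d≢0)) ⟩
      1# * c                                          ≈⟨ *-identityˡ c ⟩
      c                                               ∎

    -- A path between distinct vertices begins with an edge.
    connected⇒d≢0 : Connected → ∀ {u v} → u ≢ v → d ≢ 0
    connected⇒d≢0 connected {u} {v} u≢v with connected u v
    ... | ε          = contradiction ≡.refl u≢v
    ... | _◅_ {j = w} u~w _ = card≢0 (adj u) w u~w ∘ ≡.trans (regular u)

  -- Choice of the initial measure and decay of its deviation

  module SparseStart {n d} (G : Graph (suc n)) (connected : Graph.Connected G) (regular : Graph.Regular G d)
                     (ev : Vector Carrier (suc n)) (spectrum : IsSpectrum (AD⁻¹ G) ev) (decreasing : DecreasingAbs ev)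
                     (ev₀≈1 : ev zero ≈ 1#) (ℓ : ℕ) (1≤ℓ : 1 ℕ.≤ ℓ) (ℓ<1+n : ℓ ℕ.< suc n) where

    M : Matrix (suc n)
    M = AD⁻¹ G

    M-sym : IsSymmetric M
    M-sym = AD⁻¹-symmetric G regular

    d≢0 : d ≢ 0
    d≢0 = connected⇒d≢0 G regular connected zero≢one
      where
      1<1+n : 1 ℕ.< suc n
      1<1+n = ℕ.≤-<-trans 1≤ℓ ℓ<1+n
      zero≢one : zero ≢ Fin.fromℕ< 1<1+n
      zero≢one eq = contradiction (≡.trans (≡.cong toℕ eq) (Fin.toℕ-fromℕ< 1<1+n)) λ ()

    square-decreasing : ∀ i j → i Fin.≤ j → ev j * ev j ≤ ev i * ev i
    square-decreasing i j i≤j = ∣x∣≤∣y∣⇒x²≤y² (decreasing i j i≤j)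

    -- Makes 2 admissible as τ: otherwise 2² ≤ 1² by the ordering of the eigenvalues.
    ev≉2 : ∀ i → ¬ (ev i ≈ 1# + 1#)
    ev≉2 i evi≈2 = 1≰0 (≤-trans 1≤3 3≤0)
      where
      3# : Carrier
      3# = 1# + (1# + 1#)
      1≤3 : 1# ≤ 3#
      1≤3 = ≤-by (+-nonneg 0≤1 0≤1) (solve 0 (1: :+ (1: :+ 1:) :- 1: := 1: :+ 1:) refl)
      4≤1 : (1# + 1#) * (1# + 1#) ≤ 1# * 1#
      4≤1 = ≤-respˡ-≈ (*-cong evi≈2 evi≈2) (≤-respʳ-≈ (*-cong ev₀≈1 ev₀≈1) (square-decreasing zero i ℕ.z≤n))
      3≤0 : 3# ≤ 0#
      3≤0 = ≤-by (x≤y⇒0≤y-x 4≤1)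
        (solve 0 (0: :- (1: :+ (1: :+ 1:)) := 1: :* 1: :- (1: :+ 1:) :* (1: :+ 1:)) refl)

    abstract
      -- With the constant vector prescribed as the first member, the product with it is the sum of
      -- the entries. No root has been moved yet, so `q` is 1.
      basis : ∃[ F ] ∀ j → Eigenfamily.vec {M = M} {ev} F zero j ≡ 1#
      basis = eigenfamily-extending M M-sym ev (1# + 1#) ev≉2 (λ _ → 1#) (lipschitz-const 1#)
        (λ x → trans (spectrum x) (sym (*-identityˡ _))) (λ _ → 1#) (zero , 0≉1 ∘ sym)
        (λ i → trans (AD⁻¹-const G regular d≢0 1# i) (sym (trans (*-identityʳ _) ev₀≈1)))

    open Eigenfamily (proj₁ basis) renaming (vec to e)
    open OrthogonalBasis nonzero orthogonal

    e₀≈1 : ∀ j → e zero j ≈ 1#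
    e₀≈1 j = reflexive (proj₂ basis j)

    u : Carrier
    u = fromℕ (suc n) ⁻¹

    1+n≢0 : suc n ≢ 0
    1+n≢0 ()

    sum-uniform : sum {suc n} (λ _ → u) ≈ 1#
    sum-uniform = trans (sum-const (suc n) u) (⁻¹-inverseʳ (fromℕ≉0 1+n≢0))

    index : Fin ℓ → Fin (suc n)
    index i = Fin.inject≤ i (ℕ.<⇒≤ ℓ<1+n)

    index-fromℕ< : ∀ {i} (i<ℓ : toℕ i ℕ.< ℓ) → index (Fin.fromℕ< i<ℓ) ≡ i
    index-fromℕ< i<ℓ = Fin.toℕ-injective (≡.trans (Fin.toℕ-inject≤ _ _) (Fin.toℕ-fromℕ< i<ℓ))

    abstract
      -- Because 1 ≤ ℓ, the constant vector is among the conditions, and the sparse vector inherits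
      -- total mass 1 from the uniform one.
      sparse : ∃[ ν ] (∀ j → 0# ≤ ν j) × (∀ i → e (index i) · ν ≈ e (index i) · (λ _ → u)) × card (support ν) ℕ.≤ ℓ
      sparse = carathéodory (suc n) (e ∘ index) {λ _ → u} (λ _ → ⁻¹-nonneg (fromℕ-nonneg (suc n)) (fromℕ≉0 1+n≢0))

    μ₀ : Vector Carrier (suc n)
    μ₀ = proj₁ sparse

    agree : ∀ i → toℕ i ℕ.< ℓ → e i · μ₀ ≈ e i · (λ _ → u)
    agree i i<ℓ = ≡.subst (λ i → e i · μ₀ ≈ e i · (λ _ → u)) (index-fromℕ< i<ℓ) (proj₁ (proj₂ (proj₂ sparse)) (Fin.fromℕ< i<ℓ))

    e₀· : ∀ ν → e zero · ν ≈ sum ν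
    e₀· ν = sum-cong λ j → trans (*-congʳ (e₀≈1 j)) (*-identityˡ (ν j))

    probability : IsProbability μ₀
    probability = proj₁ (proj₂ sparse) , (begin
      sum μ₀                    ≈⟨ e₀· μ₀ ⟨
      e zero · μ₀               ≈⟨ agree zero 1≤ℓ ⟩
      e zero · (λ _ → u)        ≈⟨ e₀· (λ _ → u) ⟩
      sum {suc n} (λ _ → u)     ≈⟨ sum-uniform ⟩
      1#                        ∎)

    deviation : ℕ → Vector Carrier (suc n)
    deviation k v = walk G μ₀ k v - u

    deviation-suc : ∀ k v → deviation (suc k) v ≈ (M ⊗ᵥ deviation k) v
    deviation-suc k v = begin
      (M ⊗ᵥ walk G μ₀ k) v - u
        ≈⟨ +-congˡ (-‿cong (AD⁻¹-const G regular d≢0 u v)) ⟨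
      (M ⊗ᵥ walk G μ₀ k) v - (M ⊗ᵥ (λ _ → u)) v
        ≈⟨ sum-sub (λ j → M v j * walk G μ₀ k j) (λ j → M v j * u) ⟨
      sum (λ j → M v j * walk G μ₀ k j - M v j * u)
        ≈⟨ sum-cong (λ j → solve 3 (λ m w u → m :* w :- m :* u := m :* (w :- u)) refl (M v j) (walk G μ₀ k j) u) ⟩
      (M ⊗ᵥ deviation k) v ∎

    -- True for k = 0 by the choice of `μ₀`. A step of the walk moves `M` across the dot product
    -- onto `e i`, which only multiplies the product by `ev i`.
    deviation⊥e : ∀ k i → toℕ i ℕ.< ℓ → deviation k · e i ≈ 0#
    deviation⊥e zero i i<ℓ = begin
      deviation 0 · e i
        ≈⟨ sum-cong (λ j → solve 3 (λ m u e → (m :- u) :* e := e :* m :- e :* u) refl (μ₀ j) u (e i j)) ⟩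
      sum (λ j → e i j * μ₀ j - e i j * u)     ≈⟨ sum-sub (λ j → e i j * μ₀ j) (λ j → e i j * u) ⟩
      e i · μ₀ - e i · (λ _ → u)               ≈⟨ x≈y⇒x-y≈0 (agree i i<ℓ) ⟩
      0#                                       ∎
    deviation⊥e (suc k) i i<ℓ = begin
      deviation (suc k) · e i                  ≈⟨ ·-cong (deviation-suc k) (λ j → refl {e i j}) ⟩
      (M ⊗ᵥ deviation k) · e i                 ≈⟨ ⊗ᵥ-·-adjoint M-sym (deviation k) (e i) ⟩
      deviation k · (M ⊗ᵥ e i)                 ≈⟨ ·-cong (λ j → refl {deviation k j}) (eigen i) ⟩
      deviation k · (λ j → ev i * e i j)       ≈⟨ ·-comm (deviation k) (λ j → ev i * e i j) ⟩
      (λ j → ev i * e i j) · deviation k       ≈⟨ ·-scaleˡ (ev i) (e i) (deviation k) ⟩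
      ev i * e i · deviation k
        ≈⟨ *-congˡ (trans (·-comm (e i) (deviation k)) (deviation⊥e k i i<ℓ)) ⟩
      ev i * 0#                                ≈⟨ zeroʳ (ev i) ⟩
      0#                                       ∎

    -- Indices start at 0, so position ℓ holds the eigenvalue λ_{ℓ+1}.
    evℓ : Carrier
    evℓ = ev (Fin.fromℕ< ℓ<1+n)

    contraction : ∀ k → deviation (suc k) · deviation (suc k) ≤ evℓ * evℓ * deviation k · deviation k
    contraction k = ≤-respˡ-≈ (sym (·-cong (deviation-suc k) (deviation-suc k)))
      (⊗ᵥ-contraction M-sym eigen (evℓ * evℓ) (deviation k) dichotomy)
      where
      -- The eigenvalues that could exceed `evℓ` in absolute value meet only vanishing coefficients.
      dichotomy : ∀ i → deviation k · e i ≈ 0# ⊎ ev i * ev i ≤ evℓ * evℓ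
      dichotomy i with toℕ i ℕ.<? ℓ
      ... | yes i<ℓ = inj₁ (deviation⊥e k i i<ℓ)
      ... | no  i≮ℓ = inj₂ (square-decreasing (Fin.fromℕ< ℓ<1+n) i
                        (≡.subst (ℕ._≤ toℕ i) (≡.sym (Fin.toℕ-fromℕ< ℓ<1+n)) (ℕ.≮⇒≥ i≮ℓ)))

    decay : ∀ k → deviation k · deviation k ≤ evℓ ^ (2 ℕ.* k)
    decay zero    = distance²≤1 1+n≢0 probability
    decay (suc k) = ≤-trans (contraction k) (≤-respʳ-≈ (sym power) (*-monoˡ-≤ (x²-nonneg evℓ) (decay k)))
      where
      power : evℓ ^ (2 ℕ.* suc k) ≈ evℓ * evℓ * evℓ ^ (2 ℕ.* k)
      power = begin
        evℓ ^ (2 ℕ.* suc k)             ≡⟨ ≡.cong (evℓ ^_) (ℕ.*-suc 2 k) ⟩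
        evℓ * (evℓ * evℓ ^ (2 ℕ.* k))   ≈⟨ *-assoc _ _ _ ⟨
        evℓ * evℓ * evℓ ^ (2 ℕ.* k)     ∎

    conclusion : ∃[ μ₀ ] IsProbability μ₀ × card (support μ₀) ℕ.≤ ℓ ×
                 (∀ k → sum (λ v → ∣ walk G μ₀ k v - u ∣ ^ 2) ≤ evℓ ^ (2 ℕ.* k))
    conclusion = μ₀ , probability , proj₂ (proj₂ (proj₂ sparse)) ,
      λ k → ≤-respˡ-≈ (sym (sum-cong λ v → ∣x∣^2≈x*x (deviation k v))) (decay k)

theorem1 :
    (ℝ : CompleteOrderedField) →
    let open CompleteOrderedField ℝ
        open Real ℝ
    in
    (n d : ℕ) (G : Graph n) → Graph.Connected G → Graph.Regular G d →
    (ev : Vector Carrier n) → IsSpectrum (AD⁻¹ G) ev → DecreasingAbs ev →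
    (∀ i → toℕ i ≡ 0 → ev i ≈ 1#) →
    (ℓ : ℕ) → 1 ℕ.≤ ℓ → (ℓ<n : ℓ ℕ.< n) →
    ∃[ μ₀ ] IsProbability μ₀ × card (support μ₀) ℕ.≤ ℓ ×
      (∀ k → sum (λ v → ∣ walk G μ₀ k v - fromℕ n ⁻¹ ∣ ^ 2)
               ≤ ev (fromℕ< ℓ<n) ^ (2 ℕ.* k))
theorem1 ℝ (suc n) d G connected regular ev spectrum decreasing ev₀≈1 ℓ 1≤ℓ ℓ<n =
  SparseStart.conclusion ℝ G connected regular ev spectrum decreasing (ev₀≈1 zero ≡.refl) ℓ 1≤ℓ ℓ<n
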